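{- For every $q\in(0,1)$, the competitive ratio of $q$DistProb in the random-order model is at least $(1+q)\max\{2,1/q\}-o(1)$; that is, there is an infinite sequence of instances $\mathcal{I}_1,\mathcal{I}_2,\dots$ with $\mathrm{E}[\mathrm{ALG}(\mathcal{I}_k)]/\mathrm{OPT}(\mathcal{I}_k)\ge (1+q)\max\{2,1/q\}-o(1)$ as $k\to\infty$, where $\mathrm{ALG}(\mathcal{I})$ is the total cost of $q$DistProb on $\mathcal{I}$.
   Context: Facility location: an instance is $\mathcal{I}=(M,d,U)$, where $(M,d)$ is a metric space and $U$ is a (finite, nonempty) multiset of $n$ demand points in $M$ (copies are treated as distinct demands). A facility may be opened at any point of $M$ at cost $1$. For $F\subseteq M$, $d(F,v)=\min_{u\in F}d(u,v)$ and $d(\emptyset,v)=\infty$. The cost of a set of facilities $F\subseteq M$ is $|F|+\sum_{v\in U}d(F,v)$; $\mathrm{OPT}(\mathcal{I})$ is the minimum cost. Random-order online model: the demands arrive as a uniformly random permutation $v_1,\dots,v_n$ of $U$. With $F_\ell$ the set of facilities opened by the algorithm by the end of round $\ell$ ($F_0=\emptyset$), its total cost is $|F_n|+\sum_{\ell=1}^n d(F_\ell,v_\ell)$. Expectations are over the arrival order and the coin flips of the algorithm. $q$DistProb: when $v_\ell$ arrives, with probability $\min\{q\cdot d(F_{\ell-1},v_\ell),1\}$ (fresh independent coin) set $F_\ell=F_{\ell-1}\cup\{v_\ell\}$ (paying $1$ for opening a facility at $v_\ell$), otherwise set $F_\ell=F_{\ell-1}$; assign $v_\ell$ to its nearest facility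 in $F_\ell$. -}

module Defs where

open import Data.Bool.Base using (Bool; true; false; if_then_else_)
open import Data.Integer.Base as ℤ using (+_)
open import Data.List.Base as List using (List; []; _∷_; concatMap)
open import Data.List.NonEmpty.Base as List⁺ using (List⁺; _∷_; _∷⁺_; toList)
open import Data.List.Relation.Unary.Unique.Propositional using (Unique)
open import Data.Nat.Base as ℕ using (ℕ; suc; _!)
import Data.Nat.Properties as ℕ
open import Data.Product using (Σ-syntax; ∃-syntax; _×_; _,_; proj₁; proj₂)
open import Data.Rational.Base as ℚ using (ℚ; 0ℚ; 1ℚ; ½)
import Data.Rational.Properties as ℚ
import Data.Rational.Unnormalised.Base as ℚᵘ
import Data.Rational.Unnormalised.Properties as ℚᵘ
open import Data.Rational.Solver using (module +-*-Solver)
open import Data.Sum.Base using (inj₁; inj₂)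
open import Function.Metric.Structures using (IsGeneralMetric)
open import Relation.Binary.PropositionalEquality
  using (_≡_; refl; sym; trans; cong; subst; subst₂)
open import Relation.Nullary.Decidable using (from-yes)

------------------------------------------------------------------------
-- Real numbers: Cauchy sequences of rationals, with _≈_ as equality

IsCauchy : (ℕ → ℚ) → Set
IsCauchy x = ∀ ε → 0ℚ ℚ.< ε →
  ∃[ N ] ∀ m n → N ℕ.≤ m → N ℕ.≤ n → ℚ.∣ x m ℚ.- x n ∣ ℚ.< ε

record ℝ : Set where
  constructor mkℝ
  field
    seq    : ℕ → ℚ
    cauchy : IsCauchy seq

open ℝ public

infix 4 _≤_ _<_ _≈_

_≤_ : ℝ → ℝ → Set
x ≤ y = ∀ ε → 0ℚ ℚ.< ε →
  ∃[ N ] ∀ n → N ℕ.≤ n → seq x n ℚ.≤ seq y n ℚ.+ ε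

_≈_ : ℝ → ℝ → Set
x ≈ y = x ≤ y × y ≤ x

-- x < y asks for a rational gap that persists; a termwise strict inequality
-- would also hold between equal reals.
_<_ : ℝ → ℝ → Set
x < y = Σ[ ε ∈ ℚ ] 0ℚ ℚ.< ε ×
  ∃[ N ] ∀ n → N ℕ.≤ n → seq x n ℚ.+ ε ℚ.≤ seq y n

private abstract
  p-p≡0 : ∀ p → p ℚ.- p ≡ 0ℚ
  p-p≡0 = ℚ.+-inverseʳ

  ∣p-q∣-comm : ∀ p q → ℚ.∣ p ℚ.- q ∣ ≡ ℚ.∣ q ℚ.- p ∣
  ∣p-q∣-comm p q = trans
    (cong ℚ.∣_∣ (solve 2 (λ p q → p :- q := :- (q :- p)) refl p q))
    (ℚ.∣-p∣≡∣p∣ (q ℚ.- p))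
    where open +-*-Solver

  p≤∣p∣ : ∀ p → p ℚ.≤ ℚ.∣ p ∣
  p≤∣p∣ p with ℚ.≤-total 0ℚ p
  ... | inj₁ 0≤p = ℚ.≤-reflexive (sym (ℚ.0≤p⇒∣p∣≡p 0≤p))
  ... | inj₂ p≤0 = ℚ.≤-trans p≤0 (ℚ.0≤∣p∣ p)

  p≤q+∣p-q∣ : ∀ p q → p ℚ.≤ q ℚ.+ ℚ.∣ p ℚ.- q ∣
  p≤q+∣p-q∣ p q = subst (ℚ._≤ q ℚ.+ ℚ.∣ p ℚ.- q ∣)
    (solve 2 (λ p q → q :+ (p :- q) := p) refl p q)
    (ℚ.+-monoʳ-≤ q (p≤∣p∣ (p ℚ.- q)))
    where open +-*-Solver

  p≤q+r⇒p-q≤r : ∀ p q r → p ℚ.≤ q ℚ.+ r → p ℚ.- q ℚ.≤ r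
  p≤q+r⇒p-q≤r p q r h = subst (p ℚ.- q ℚ.≤_)
    (solve 2 (λ q r → q :+ r :- q := r) refl q r)
    (ℚ.+-monoˡ-≤ (ℚ.- q) h)
    where open +-*-Solver

  ∣p-q∣≤r : ∀ p q r → p ℚ.≤ q ℚ.+ r → q ℚ.≤ p ℚ.+ r → ℚ.∣ p ℚ.- q ∣ ℚ.≤ r
  ∣p-q∣≤r p q r h₁ h₂ with ℚ.≤-total 0ℚ (p ℚ.- q)
  ... | inj₁ 0≤p-q = subst (ℚ._≤ r) (sym (ℚ.0≤p⇒∣p∣≡p 0≤p-q)) (p≤q+r⇒p-q≤r p q r h₁)
  ... | inj₂ p-q≤0 = subst (ℚ._≤ r)
    (sym (trans (∣p-q∣-comm p q) (ℚ.0≤p⇒∣p∣≡p 0≤q-p)))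
    (p≤q+r⇒p-q≤r q p r h₂)
    where
    open +-*-Solver
    0≤q-p : 0ℚ ℚ.≤ q ℚ.- p
    0≤q-p = subst (0ℚ ℚ.≤_) (solve 2 (λ p q → :- (p :- q) := q :- p) refl p q)
      (ℚ.neg-antimono-≤ p-q≤0)

  -- A sequence that varies no more than K times as much as x and y together.
  dominated : (x y : ℝ) (z : ℕ → ℚ) (K : ℚ) → 0ℚ ℚ.< K → (N₀ : ℕ) →
    (∀ m n → N₀ ℕ.≤ m → N₀ ℕ.≤ n →
      ℚ.∣ z m ℚ.- z n ∣ ℚ.≤
      K ℚ.* (ℚ.∣ seq x m ℚ.- seq x n ∣ ℚ.+ ℚ.∣ seq y m ℚ.- seq y n ∣)) →
    IsCauchy z
  dominated x y z K 0<K N₀ h ε 0<ε = N , bound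
    where
    instance
      posK : ℚ.Positive K
      posK = ℚ.positive 0<K
      nzK : ℚ.NonZero K
      nzK = ℚ.pos⇒nonZero K
      pos1/K : ℚ.Positive (ℚ.1/ K)
      pos1/K = ℚ.1/pos⇒pos K
      posε : ℚ.Positive ε
      posε = ℚ.positive 0<ε
      posη₀ : ℚ.Positive (ℚ.1/ K ℚ.* ε)
      posη₀ = ℚ.pos*pos⇒pos (ℚ.1/ K) ε
    η : ℚ
    η = ½ ℚ.* (ℚ.1/ K ℚ.* ε)
    0<η : 0ℚ ℚ.< η
    0<η = ℚ.positive⁻¹ η {{ℚ.pos*pos⇒pos ½ (ℚ.1/ K ℚ.* ε)}}
    K[η+η]≡ε : K ℚ.* (η ℚ.+ η) ≡ ε
    K[η+η]≡ε = trans
      (solve 3 (λ k k⁻¹ e →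
        k :* (con ½ :* (k⁻¹ :* e) :+ con ½ :* (k⁻¹ :* e)) := (k :* k⁻¹) :* e)
        refl K (ℚ.1/ K) ε)
      (trans (cong (ℚ._* ε) (ℚ.*-inverseʳ K)) (ℚ.*-identityˡ ε))
      where open +-*-Solver
    Nx Ny N : ℕ
    Nx = proj₁ (cauchy x η 0<η)
    Ny = proj₁ (cauchy y η 0<η)
    N = N₀ ℕ.⊔ (Nx ℕ.⊔ Ny)
    N₀≤ : ∀ {m} → N ℕ.≤ m → N₀ ℕ.≤ m
    N₀≤ = ℕ.≤-trans (ℕ.m≤m⊔n N₀ _)
    Nx≤ : ∀ {m} → N ℕ.≤ m → Nx ℕ.≤ m
    Nx≤ = ℕ.≤-trans (ℕ.≤-trans (ℕ.m≤m⊔n Nx Ny) (ℕ.m≤n⊔m N₀ _))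
    Ny≤ : ∀ {m} → N ℕ.≤ m → Ny ℕ.≤ m
    Ny≤ = ℕ.≤-trans (ℕ.≤-trans (ℕ.m≤n⊔m Nx Ny) (ℕ.m≤n⊔m N₀ _))
    bound : ∀ m n → N ℕ.≤ m → N ℕ.≤ n → ℚ.∣ z m ℚ.- z n ∣ ℚ.< ε
    bound m n N≤m N≤n = ℚ.≤-<-trans (h m n (N₀≤ N≤m) (N₀≤ N≤n))
      (subst (_ ℚ.<_) K[η+η]≡ε
        (ℚ.*-monoʳ-<-pos K (ℚ.+-mono-<
          (proj₂ (cauchy x η 0<η) m n (Nx≤ N≤m) (Nx≤ N≤n))
          (proj₂ (cauchy y η 0<η) m n (Ny≤ N≤m) (Ny≤ N≤n)))))

  0<1 : 0ℚ ℚ.< 1ℚ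
  0<1 = from-yes (0ℚ ℚ.<? 1ℚ)

  dominated₁ : (x y : ℝ) (z : ℕ → ℚ) →
    (∀ m n → ℚ.∣ z m ℚ.- z n ∣ ℚ.≤
             ℚ.∣ seq x m ℚ.- seq x n ∣ ℚ.+ ℚ.∣ seq y m ℚ.- seq y n ∣) →
    IsCauchy z
  dominated₁ x y z h = dominated x y z 1ℚ 0<1 0 λ m n _ _ →
    subst (ℚ.∣ z m ℚ.- z n ∣ ℚ.≤_) (sym (ℚ.*-identityˡ _)) (h m n)

  bounded : (x : ℝ) →
    Σ[ B ∈ ℚ ] 0ℚ ℚ.≤ B × ∃[ N ] ∀ n → N ℕ.≤ n → ℚ.∣ seq x n ∣ ℚ.≤ B
  bounded x = B , 0≤B , N , bound
    where
    N : ℕ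
    N = proj₁ (cauchy x 1ℚ 0<1)
    c B : ℚ
    c = seq x N
    B = ℚ.∣ c ∣ ℚ.+ 1ℚ
    0≤B : 0ℚ ℚ.≤ B
    0≤B = ℚ.+-mono-≤ (ℚ.0≤∣p∣ c) (ℚ.<⇒≤ 0<1)
    bound : ∀ n → N ℕ.≤ n → ℚ.∣ seq x n ∣ ℚ.≤ B
    bound n N≤n = ℚ.≤-trans
      (subst (λ p → ℚ.∣ p ∣ ℚ.≤ ℚ.∣ c ∣ ℚ.+ ℚ.∣ seq x n ℚ.- c ∣)
        (solve 2 (λ a b → b :+ (a :- b) := a) refl (seq x n) c)
        (ℚ.∣p+q∣≤∣p∣+∣q∣ c (seq x n ℚ.- c)))
      (ℚ.+-monoʳ-≤ ℚ.∣ c ∣ (ℚ.<⇒≤ (proj₂ (cauchy x 1ℚ 0<1) n N N≤n ℕ.≤-refl)))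
      where open +-*-Solver

  const-cauchy : ∀ p → IsCauchy (λ _ → p)
  const-cauchy p ε 0<ε = 0 , λ _ _ _ _ →
    subst (ℚ._< ε) (sym (cong ℚ.∣_∣ (p-p≡0 p))) 0<ε

fromℚ : ℚ → ℝ
fromℚ p = mkℝ (λ _ → p) (const-cauchy p)

fromℕ : ℕ → ℝ
fromℕ n = fromℚ (+ n ℚ./ 1)

0ℝ 1ℝ 2ℝ : ℝ
0ℝ = fromℕ 0
1ℝ = fromℕ 1
2ℝ = fromℕ 2

infixl 6 _+_ _-_
infixl 7 _*_ _⊓_
infixl 6 _⊔_
infix  8 -_

private abstract
  +-cauchy : ∀ x y → IsCauchy (λ n → seq x n ℚ.+ seq y n)
  +-cauchy x y = dominated₁ x y (λ n → seq x n ℚ.+ seq y n) λ m n →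
    subst (ℚ._≤ ℚ.∣ seq x m ℚ.- seq x n ∣ ℚ.+ ℚ.∣ seq y m ℚ.- seq y n ∣)
      (cong ℚ.∣_∣ (eq (seq x m) (seq y m) (seq x n) (seq y n)))
      (ℚ.∣p+q∣≤∣p∣+∣q∣ (seq x m ℚ.- seq x n) (seq y m ℚ.- seq y n))
    where
    eq : ∀ a b c d → (a ℚ.- c) ℚ.+ (b ℚ.- d) ≡ (a ℚ.+ b) ℚ.- (c ℚ.+ d)
    eq = solve 4 (λ a b c d → (a :- c) :+ (b :- d) := (a :+ b) :- (c :+ d)) refl
      where open +-*-Solver

_+_ : ℝ → ℝ → ℝ
x + y = mkℝ (λ n → seq x n ℚ.+ seq y n) (+-cauchy x y)

private abstract
  neg-cauchy : ∀ x → IsCauchy (λ n → ℚ.- seq x n)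
  neg-cauchy x ε 0<ε = proj₁ (cauchy x ε 0<ε) , λ m n N≤m N≤n →
    subst (ℚ._< ε)
      (trans (sym (ℚ.∣-p∣≡∣p∣ (seq x m ℚ.- seq x n))) (cong ℚ.∣_∣ (eq (seq x m) (seq x n))))
      (proj₂ (cauchy x ε 0<ε) m n N≤m N≤n)
    where
    eq : ∀ a b → ℚ.- (a ℚ.- b) ≡ ℚ.- a ℚ.- ℚ.- b
    eq = solve 2 (λ a b → :- (a :- b) := :- a :- :- b) refl
      where open +-*-Solver

-_ : ℝ → ℝ
- x = mkℝ (λ n → ℚ.- seq x n) (neg-cauchy x)

_-_ : ℝ → ℝ → ℝ
x - y = x + - y

private abstract
  *-cauchy : ∀ x y → IsCauchy (λ n → seq x n ℚ.* seq y n)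
  *-cauchy x y =
    dominated x y (λ n → seq x n ℚ.* seq y n) K 0<K (Nx ℕ.⊔ Ny) bound
    where
    Bx By K : ℚ
    Bx = proj₁ (bounded x)
    By = proj₁ (bounded y)
    K = Bx ℚ.+ By ℚ.+ 1ℚ
    0≤Bx : 0ℚ ℚ.≤ Bx
    0≤Bx = proj₁ (proj₂ (bounded x))
    0≤By : 0ℚ ℚ.≤ By
    0≤By = proj₁ (proj₂ (bounded y))
    Nx Ny : ℕ
    Nx = proj₁ (proj₂ (proj₂ (bounded x)))
    Ny = proj₁ (proj₂ (proj₂ (bounded y)))
    0<K : 0ℚ ℚ.< K
    0<K = ℚ.+-mono-≤-< (ℚ.+-mono-≤ 0≤Bx 0≤By) 0<1
    Bx≤K : Bx ℚ.≤ K
    Bx≤K = subst₂ ℚ._≤_ (ℚ.+-identityʳ Bx) (sym (ℚ.+-assoc Bx By 1ℚ))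
      (ℚ.+-monoʳ-≤ Bx (ℚ.+-mono-≤ 0≤By (ℚ.<⇒≤ 0<1)))
    By≤K : By ℚ.≤ K
    By≤K = subst₂ ℚ._≤_ (ℚ.+-identityʳ By)
      (solve 2 (λ a b → b :+ (a :+ con 1ℚ) := a :+ b :+ con 1ℚ) refl Bx By)
      (ℚ.+-monoʳ-≤ By (ℚ.+-mono-≤ 0≤Bx (ℚ.<⇒≤ 0<1)))
      where open +-*-Solver
    term : ∀ a b → ℚ.∣ a ∣ ℚ.≤ K → ℚ.∣ a ℚ.* b ∣ ℚ.≤ K ℚ.* ℚ.∣ b ∣
    term a b h = subst (ℚ._≤ K ℚ.* ℚ.∣ b ∣) (sym (ℚ.∣p*q∣≡∣p∣*∣q∣ a b))
      (ℚ.*-monoʳ-≤-nonNeg ℚ.∣ b ∣ {{ℚ.∣-∣-nonNeg b}} h)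
    bound : ∀ m n → Nx ℕ.⊔ Ny ℕ.≤ m → Nx ℕ.⊔ Ny ℕ.≤ n →
      ℚ.∣ seq x m ℚ.* seq y m ℚ.- seq x n ℚ.* seq y n ∣ ℚ.≤
      K ℚ.* (ℚ.∣ seq x m ℚ.- seq x n ∣ ℚ.+ ℚ.∣ seq y m ℚ.- seq y n ∣)
    eq : ∀ a b c d → b ℚ.* (a ℚ.- c) ℚ.+ c ℚ.* (b ℚ.- d) ≡ a ℚ.* b ℚ.- c ℚ.* d
    eq = solve 4 (λ a b c d → b :* (a :- c) :+ c :* (b :- d) := a :* b :- c :* d) refl
      where open +-*-Solver
    bound m n N≤m N≤n = subst₂ ℚ._≤_
      (cong ℚ.∣_∣ (eq (seq x m) (seq y m) (seq x n) (seq y n)))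
      (sym (ℚ.*-distribˡ-+ K ℚ.∣ seq x m ℚ.- seq x n ∣ ℚ.∣ seq y m ℚ.- seq y n ∣))
      (ℚ.≤-trans
        (ℚ.∣p+q∣≤∣p∣+∣q∣ (seq y m ℚ.* (seq x m ℚ.- seq x n)) (seq x n ℚ.* (seq y m ℚ.- seq y n)))
        (ℚ.+-mono-≤
          (term (seq y m) (seq x m ℚ.- seq x n)
            (ℚ.≤-trans (proj₂ (proj₂ (proj₂ (bounded y))) m (ℕ.≤-trans (ℕ.m≤n⊔m Nx Ny) N≤m)) By≤K))
          (term (seq x n) (seq y m ℚ.- seq y n)
            (ℚ.≤-trans (proj₂ (proj₂ (proj₂ (bounded x))) n (ℕ.≤-trans (ℕ.m≤m⊔n Nx Ny) N≤n)) Bx≤K))))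

_*_ : ℝ → ℝ → ℝ
x * y = mkℝ (λ n → seq x n ℚ.* seq y n) (*-cauchy x y)

private abstract
  p≤p+∣q∣ : ∀ p q → p ℚ.≤ p ℚ.+ ℚ.∣ q ∣
  p≤p+∣q∣ p q = subst (ℚ._≤ p ℚ.+ ℚ.∣ q ∣) (ℚ.+-identityʳ p) (ℚ.+-monoʳ-≤ p (ℚ.0≤∣p∣ q))

  p≤∣q∣+p : ∀ p q → p ℚ.≤ ℚ.∣ q ∣ ℚ.+ p
  p≤∣q∣+p p q = subst (ℚ._≤ ℚ.∣ q ∣ ℚ.+ p) (ℚ.+-identityˡ p) (ℚ.+-monoˡ-≤ p (ℚ.0≤∣p∣ q))

  ⊔-shift : ∀ a b c d →
    (a ℚ.⊔ b) ℚ.≤ (c ℚ.⊔ d) ℚ.+ (ℚ.∣ a ℚ.- c ∣ ℚ.+ ℚ.∣ b ℚ.- d ∣)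
  ⊔-shift a b c d = ℚ.⊔-lub
    (ℚ.≤-trans (p≤q+∣p-q∣ a c) (ℚ.+-mono-≤ (ℚ.p≤p⊔q c d)
      (p≤p+∣q∣ ℚ.∣ a ℚ.- c ∣ (b ℚ.- d))))
    (ℚ.≤-trans (p≤q+∣p-q∣ b d) (ℚ.+-mono-≤ (ℚ.p≤q⊔p c d)
      (p≤∣q∣+p ℚ.∣ b ℚ.- d ∣ (a ℚ.- c))))

  ⊔-dist : ∀ a b c d →
    ℚ.∣ (a ℚ.⊔ b) ℚ.- (c ℚ.⊔ d) ∣ ℚ.≤ ℚ.∣ a ℚ.- c ∣ ℚ.+ ℚ.∣ b ℚ.- d ∣
  ⊔-dist a b c d = ∣p-q∣≤r (a ℚ.⊔ b) (c ℚ.⊔ d) (ℚ.∣ a ℚ.- c ∣ ℚ.+ ℚ.∣ b ℚ.- d ∣) (⊔-shift a b c d)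
    (subst₂ (λ s t → (c ℚ.⊔ d) ℚ.≤ (a ℚ.⊔ b) ℚ.+ (s ℚ.+ t))
      (∣p-q∣-comm c a) (∣p-q∣-comm d b) (⊔-shift c d a b))

  ⊓-shift : ∀ a b c d →
    (a ℚ.⊓ b) ℚ.≤ (c ℚ.⊓ d) ℚ.+ (ℚ.∣ a ℚ.- c ∣ ℚ.+ ℚ.∣ b ℚ.- d ∣)
  ⊓-shift a b c d with ℚ.⊓-sel c d
  ... | inj₁ eq rewrite eq = ℚ.≤-trans (ℚ.p⊓q≤p a b)
    (ℚ.≤-trans (p≤q+∣p-q∣ a c) (ℚ.+-monoʳ-≤ c
      (p≤p+∣q∣ ℚ.∣ a ℚ.- c ∣ (b ℚ.- d))))
  ... | inj₂ eq rewrite eq = ℚ.≤-trans (ℚ.p⊓q≤q a b)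
    (ℚ.≤-trans (p≤q+∣p-q∣ b d) (ℚ.+-monoʳ-≤ d
      (p≤∣q∣+p ℚ.∣ b ℚ.- d ∣ (a ℚ.- c))))

  ⊓-dist : ∀ a b c d →
    ℚ.∣ (a ℚ.⊓ b) ℚ.- (c ℚ.⊓ d) ∣ ℚ.≤ ℚ.∣ a ℚ.- c ∣ ℚ.+ ℚ.∣ b ℚ.- d ∣
  ⊓-dist a b c d = ∣p-q∣≤r (a ℚ.⊓ b) (c ℚ.⊓ d) (ℚ.∣ a ℚ.- c ∣ ℚ.+ ℚ.∣ b ℚ.- d ∣) (⊓-shift a b c d)
    (subst₂ (λ s t → (c ℚ.⊓ d) ℚ.≤ (a ℚ.⊓ b) ℚ.+ (s ℚ.+ t))
      (∣p-q∣-comm c a) (∣p-q∣-comm d b) (⊓-shift c d a b))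

  ⊔-cauchy : ∀ x y → IsCauchy (λ n → seq x n ℚ.⊔ seq y n)
  ⊔-cauchy x y = dominated₁ x y (λ n → seq x n ℚ.⊔ seq y n) λ m n →
    ⊔-dist (seq x m) (seq y m) (seq x n) (seq y n)

  ⊓-cauchy : ∀ x y → IsCauchy (λ n → seq x n ℚ.⊓ seq y n)
  ⊓-cauchy x y = dominated₁ x y (λ n → seq x n ℚ.⊓ seq y n) λ m n →
    ⊓-dist (seq x m) (seq y m) (seq x n) (seq y n)

_⊔_ : ℝ → ℝ → ℝ
x ⊔ y = mkℝ (λ n → seq x n ℚ.⊔ seq y n) (⊔-cauchy x y)

_⊓_ : ℝ → ℝ → ℝ
x ⊓ y = mkℝ (λ n → seq x n ℚ.⊓ seq y n) (⊓-cauchy x y)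

-- With ε the gap witnessing 0 < x, the terms 1 / (xₙ ⊔ ε) are defined for all n
-- and equal 1 / xₙ for all large n.
inv : (x : ℝ) → 0ℝ < x → ℝ
inv x (ε , 0<ε , N , _) = mkℝ r (dominated x x r K 0<K 0 bound)
  where
  instance
    posε : ℚ.Positive ε
    posε = ℚ.positive 0<ε
    nzε : ℚ.NonZero ε
    nzε = ℚ.pos⇒nonZero ε
    pos1/ε : ℚ.Positive (ℚ.1/ ε)
    pos1/ε = ℚ.1/pos⇒pos ε
    posK : ℚ.Positive (ℚ.1/ ε ℚ.* ℚ.1/ ε)
    posK = ℚ.pos*pos⇒pos (ℚ.1/ ε) (ℚ.1/ ε)
  s : ℕ → ℚ
  s n = seq x n ℚ.⊔ ε
  poss : ∀ n → ℚ.Positive (s n)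
  poss n = ℚ.positive (ℚ.<-≤-trans 0<ε (ℚ.p≤q⊔p (seq x n) ε))
  nzs : ∀ n → ℚ.NonZero (s n)
  nzs n = ℚ.pos⇒nonZero (s n) {{poss n}}
  r : ℕ → ℚ
  r n = ℚ.1/_ (s n) {{nzs n}}
  K : ℚ
  K = ℚ.1/ ε ℚ.* ℚ.1/ ε
  0<K : 0ℚ ℚ.< K
  0<K = ℚ.positive⁻¹ K
  posr : ∀ n → ℚ.Positive (r n)
  posr n = ℚ.1/pos⇒pos (s n) {{poss n}}
  sr≡1 : ∀ n → s n ℚ.* r n ≡ 1ℚ
  sr≡1 n = ℚ.*-inverseʳ (s n) {{nzs n}}
  r≤1/ε : ∀ n → r n ℚ.≤ ℚ.1/ ε
  r≤1/ε n = subst₂ ℚ._≤_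
    (trans (sym (ℚ.*-assoc (ℚ.1/ ε) ε (r n)))
      (trans (cong (ℚ._* r n) (ℚ.*-inverseˡ ε)) (ℚ.*-identityˡ (r n))))
    (trans (cong (ℚ.1/ ε ℚ.*_) (sr≡1 n)) (ℚ.*-identityʳ (ℚ.1/ ε)))
    (ℚ.*-monoˡ-≤-nonNeg (ℚ.1/ ε) {{ℚ.pos⇒nonNeg (ℚ.1/ ε)}}
      (ℚ.*-monoʳ-≤-nonNeg (r n) {{ℚ.pos⇒nonNeg (r n) {{posr n}}}}
        (ℚ.p≤q⊔p (seq x n) ε)))
  diff : ∀ m n → r m ℚ.- r n ≡ (r m ℚ.* r n) ℚ.* (s n ℚ.- s m)
  diff m n = sym (trans
    (solve 4 (λ a b c d → (a :* b) :* (d :- c) := (d :* b) :* a :- (c :* a) :* b) refl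
      (r m) (r n) (s m) (s n))
    (subst₂ (λ u v → u ℚ.* r m ℚ.- v ℚ.* r n ≡ r m ℚ.- r n)
      (sym (sr≡1 n)) (sym (sr≡1 m))
      (subst₂ (λ u v → u ℚ.- v ≡ r m ℚ.- r n)
        (sym (ℚ.*-identityˡ (r m))) (sym (ℚ.*-identityˡ (r n))) refl)))
    where open +-*-Solver
  ∣rr∣≤K : ∀ m n → ℚ.∣ r m ℚ.* r n ∣ ℚ.≤ K
  ∣rr∣≤K m n = subst (ℚ._≤ K)
    (sym (ℚ.0≤p⇒∣p∣≡p (ℚ.<⇒≤ (ℚ.positive⁻¹ _ {{ℚ.pos*pos⇒pos (r m) {{posr m}} (r n) {{posr n}}}}))))
    (ℚ.≤-trans
      (ℚ.*-monoʳ-≤-nonNeg (r n) {{ℚ.pos⇒nonNeg (r n) {{posr n}}}} (r≤1/ε m))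
      (ℚ.*-monoˡ-≤-nonNeg (ℚ.1/ ε) {{ℚ.pos⇒nonNeg (ℚ.1/ ε)}} (r≤1/ε n)))
  ∣s-s∣≤ : ∀ m n → ℚ.∣ s n ℚ.- s m ∣ ℚ.≤
    ℚ.∣ seq x m ℚ.- seq x n ∣ ℚ.+ ℚ.∣ seq x m ℚ.- seq x n ∣
  ∣s-s∣≤ m n = ℚ.≤-trans
    (subst (ℚ._≤ ℚ.∣ seq x m ℚ.- seq x n ∣ ℚ.+ ℚ.∣ ε ℚ.- ε ∣) (∣p-q∣-comm (s m) (s n)) (⊔-dist (seq x m) ε (seq x n) ε))
    (ℚ.+-monoʳ-≤ ℚ.∣ seq x m ℚ.- seq x n ∣
      (subst (ℚ._≤ ℚ.∣ seq x m ℚ.- seq x n ∣) (sym (cong ℚ.∣_∣ (p-p≡0 ε))) (ℚ.0≤∣p∣ (seq x m ℚ.- seq x n))))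
  bound : ∀ m n → 0 ℕ.≤ m → 0 ℕ.≤ n → ℚ.∣ r m ℚ.- r n ∣ ℚ.≤
    K ℚ.* (ℚ.∣ seq x m ℚ.- seq x n ∣ ℚ.+ ℚ.∣ seq x m ℚ.- seq x n ∣)
  bound m n _ _ = subst
    (ℚ._≤ K ℚ.* (ℚ.∣ seq x m ℚ.- seq x n ∣ ℚ.+ ℚ.∣ seq x m ℚ.- seq x n ∣))
    (sym (trans (cong ℚ.∣_∣ (diff m n)) (ℚ.∣p*q∣≡∣p∣*∣q∣ (r m ℚ.* r n) (s n ℚ.- s m))))
    (ℚ.≤-trans
      (ℚ.*-monoʳ-≤-nonNeg ℚ.∣ s n ℚ.- s m ∣ {{ℚ.∣-∣-nonNeg (s n ℚ.- s m)}} (∣rr∣≤K m n))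
      (ℚ.*-monoˡ-≤-nonNeg K {{ℚ.pos⇒nonNeg K}} (∣s-s∣≤ m n)))

infixl 7 _/_[_]

_/_[_] : ℝ → (y : ℝ) → 0ℝ < y → ℝ
x / y [ 0<y ] = x * inv y 0<y

sum : List ℝ → ℝ
sum = List.foldr _+_ 0ℝ

TendsToZero : (ℕ → ℝ) → Set
TendsToZero δ = ∀ ε → 0ℝ < ε →
  ∃[ K ] ∀ k → K ℕ.≤ k → - ε < δ k × δ k < ε

------------------------------------------------------------------------
-- Finitely supported probability distributions, as weighted lists of outcomes

Dist : Set → Set
Dist A = List (ℝ × A)

point : {A : Set} → A → Dist A
point a = (1ℝ , a) ∷ []

infixl 1 _>>=_

_>>=_ : {A B : Set} → Dist A → (A → Dist B) → Dist B
μ >>= f = concatMap (λ (w , a) → List.map (λ (w′ , b) → w * w′ , b) (f a)) μ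

bernoulli : ℝ → Dist Bool
bernoulli p = (p , true) ∷ (1ℝ - p , false) ∷ []

insertions : {A : Set} → A → List A → List (List A)
insertions x []       = (x ∷ []) ∷ []
insertions x (y ∷ ys) = (x ∷ y ∷ ys) ∷ List.map (y ∷_) (insertions x ys)

-- The n! arrangements of a list of length n; equal entries are not identified.
permutations : {A : Set} → List A → List (List A)
permutations []       = [] ∷ []
permutations (x ∷ xs) = concatMap (insertions x) (permutations xs)

randomOrder : {A : Set} → List A → Dist (List A)
randomOrder xs = List.map (λ ys → fromℚ (ℚ._/_ (+ 1) (n !) {{n ℕ.!≢0}}) , ys) (permutations xs)
  where
  n : ℕ
  n = List.length xs

E : Dist ℝ → ℝ
E μ = sum (List.map (λ (w , c) → w * c) μ)

------------------------------------------------------------------------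
-- Facility location

record MetricSpace : Set₁ where
  field
    Point    : Set
    d        : Point → Point → ℝ
    isMetric : IsGeneralMetric _≡_ _≈_ _≤_ 0ℝ _+_ d

record Instance : Set₁ where
  field
    space   : MetricSpace
    demands : List⁺ (MetricSpace.Point space)

module _ (S : MetricSpace) where
  open MetricSpace S

  -- d(F,v) for F ≠ ∅; the value d(∅,v) = ∞ is dealt with where it arises.
  distance : List⁺ Point → Point → ℝ
  distance F v = List⁺.foldr₁ _⊓_ (List⁺.map (λ u → d u v) F)

  cost : List⁺ Point → List⁺ Point → ℝ
  cost U F = fromℕ (List⁺.length F) + sum (List.map (distance F) (toList U))

  module _ (q : ℝ) where

    -- With F = ∅ the opening probability is min{q·∞,1} = 1. If v is already in F it
    -- is q·0 = 0, so outcomes listing a facility twice have weight 0.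
    step : List Point → Point → Dist (List⁺ Point)
    step []      v = point (v ∷ [])
    step (f ∷ F) v =
      bernoulli ((q * distance (f ∷ F) v) ⊓ 1ℝ) >>= λ open? →
      point (if open? then v ∷⁺ (f ∷ F) else f ∷ F)

    -- |Fₙ| + Σ d(Fₗ,vₗ), summed over the rounds still to come, from the set F.
    run : List Point → List Point → Dist ℝ
    run F []       = point (fromℕ (List.length F))
    run F (v ∷ vs) =
      step F v >>= λ F′ →
      run (toList F′) vs >>= λ c →
      point (distance F′ v + c)

qDistProb : ℝ → Instance → Dist ℝ
qDistProb q I = randomOrder (toList demands) >>= run space q []
  where open Instance I

-- The sets left out of the minimum, ∅ and the infinite ones, have infinite cost.
IsOPT : Instance → ℝ → Set
IsOPT I c =
  (∃[ F ] Unique (toList F) × cost space demands F ≈ c) ×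
  (∀ F → Unique (toList F) → c ≤ cost space demands F)
  where open Instance I

≤-trans : ∀ {x y z} → x ≤ y → y ≤ z → x ≤ z
≤-trans {x} {y} {z} x≤y y≤z ε 0<ε = proj₁ p ℕ.⊔ proj₁ q , λ n N≤n →
  ℚ.≤-trans (proj₂ p n (ℕ.≤-trans (ℕ.m≤m⊔n _ (proj₁ q)) N≤n))
    (subst (seq y n ℚ.+ η ℚ.≤_)
      (solve 2 (λ a e → a :+ con ½ :* e :+ con ½ :* e := a :+ e) refl (seq z n) ε)
      (ℚ.+-monoˡ-≤ η (proj₂ q n (ℕ.≤-trans (ℕ.m≤n⊔m (proj₁ p) _) N≤n))))
  where
  open +-*-Solver
  η : ℚ
  η = ½ ℚ.* ε
  0<η : 0ℚ ℚ.< η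
  0<η = ℚ.positive⁻¹ η {{ℚ.pos*pos⇒pos ½ ε {{ℚ.positive 0<ε}}}}
  p = x≤y η 0<η
  q = y≤z η 0<η

0≤+ : ∀ {x y} → 0ℝ ≤ x → 0ℝ ≤ y → 0ℝ ≤ x + y
0≤+ {x} {y} 0≤x 0≤y ε 0<ε = proj₁ p ℕ.⊔ proj₁ q , λ n N≤n →
  subst (0ℚ ℚ.≤_)
    (solve 3 (λ a b e → (a :+ con ½ :* e) :+ (b :+ con ½ :* e) := a :+ b :+ e) refl
      (seq x n) (seq y n) ε)
    (ℚ.+-mono-≤
      (proj₂ p n (ℕ.≤-trans (ℕ.m≤m⊔n _ (proj₁ q)) N≤n))
      (proj₂ q n (ℕ.≤-trans (ℕ.m≤n⊔m (proj₁ p) _) N≤n)))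
  where
  open +-*-Solver
  η : ℚ
  η = ½ ℚ.* ε
  0<η : 0ℚ ℚ.< η
  0<η = ℚ.positive⁻¹ η {{ℚ.pos*pos⇒pos ½ ε {{ℚ.positive 0<ε}}}}
  p = 0≤x η 0<η
  q = 0≤y η 0<η

0≤⊓ : ∀ {x y} → 0ℝ ≤ x → 0ℝ ≤ y → 0ℝ ≤ x ⊓ y
0≤⊓ {x} {y} 0≤x 0≤y ε 0<ε = proj₁ p ℕ.⊔ proj₁ q , bound
  where
  p = 0≤x ε 0<ε
  q = 0≤y ε 0<ε
  bound : ∀ n → proj₁ p ℕ.⊔ proj₁ q ℕ.≤ n → 0ℚ ℚ.≤ seq x n ℚ.⊓ seq y n ℚ.+ ε
  bound n N≤n with ℚ.⊓-sel (seq x n) (seq y n)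
  ... | inj₁ eq rewrite eq = proj₂ p n (ℕ.≤-trans (ℕ.m≤m⊔n _ (proj₁ q)) N≤n)
  ... | inj₂ eq rewrite eq = proj₂ q n (ℕ.≤-trans (ℕ.m≤n⊔m (proj₁ p) _) N≤n)

1≤fromℕ+ : ∀ n {x} → 0ℝ ≤ x → 1ℝ ≤ fromℕ (suc n) + x
1≤fromℕ+ n {x} 0≤x ε 0<ε = proj₁ (0≤x ε 0<ε) , λ m N≤m →
  subst (1ℚ ℚ.≤_) (sym (ℚ.+-assoc (+ suc n ℚ./ 1) (seq x m) ε))
    (ℚ.+-mono-≤ {1ℚ} {+ suc n ℚ./ 1} 1≤ (proj₂ (0≤x ε 0<ε) m N≤m))
  where
  1≤ : 1ℚ ℚ.≤ + suc n ℚ./ 1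
  1≤ = ℚ.toℚᵘ-cancel-≤ (ℚᵘ.≤-respʳ-≃ (ℚᵘ.≃-sym (ℚ.toℚᵘ-fromℚᵘ (ℚᵘ.mkℚᵘ (+ suc n) 0)))
    (ℚᵘ.*≤* (ℤ.+≤+ (ℕ.s≤s ℕ.z≤n))))

1≤⇒0< : ∀ {x} → 1ℝ ≤ x → 0ℝ < x
1≤⇒0< {x} 1≤x = ½ , 0<½ , proj₁ p , λ n N≤n →
  subst (0ℚ ℚ.+ ½ ℚ.≤_)
    (solve 1 (λ a → a :+ con ½ :+ con (ℚ.- ½) := a) refl (seq x n))
    (ℚ.+-monoˡ-≤ (ℚ.- ½) (proj₂ p n N≤n))
  where
  open +-*-Solver
  0<½ : 0ℚ ℚ.< ½
  0<½ = from-yes (0ℚ ℚ.<? ½)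
  p = 1≤x ½ 0<½

module _ (S : MetricSpace) where
  open MetricSpace S
  open IsGeneralMetric isMetric using (nonNegative)

  0≤distance : ∀ F v → 0ℝ ≤ distance S F v
  0≤distance (f ∷ F) v = go f F
    where
    go : ∀ f F → 0ℝ ≤ distance S (f ∷ F) v
    go f []      = nonNegative
    go f (g ∷ F) = 0≤⊓ {d f v} {distance S (g ∷ F) v} nonNegative (go g F)

  0≤sum : ∀ F vs → 0ℝ ≤ sum (List.map (distance S F) vs)
  0≤sum F []       ε 0<ε = 0 , λ _ _ →
    subst (0ℚ ℚ.≤_) (sym (ℚ.+-identityˡ ε)) (ℚ.<⇒≤ 0<ε)
  0≤sum F (v ∷ vs) =
    0≤+ {distance S F v} {sum (List.map (distance S F) vs)} (0≤distance F v) (0≤sum F vs)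

0<OPT : ∀ I c → IsOPT I c → 0ℝ < c
0<OPT I c ((F@(_ ∷ Fs) , _ , cost≤c , _) , _) = 1≤⇒0< {c}
  (≤-trans {1ℝ} {cost space demands F} {c}
    (1≤fromℕ+ (List.length Fs) {sum (List.map (distance space F) (toList demands))}
      (0≤sum space F (toList demands)))
    cost≤c)
  where open Instance I

{-# OPTIONS --safe #-}

-- On a star with small radius r = D/2, all leaves are at distance D from each
-- other, and qDistProb only opens facilities at leaves. Hence the expected
-- expenditure on a leaf with c demands depends on neither the arrival order nor
-- the other leaves: A(0) = 0 and A(c+1) = qD + (1 - qD)(D + A(c)). With L leaves
-- the algorithm pays 1 + (L - 1) A(c) for every arrival order.
--   * For c = 1, A(1) = (1 + q)D - qD². Opening only the centre costs 1 + LD/2,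
--     so the ratio tends to 2(1 + q) as D → 0 and LD → ∞.
--   * For c → ∞, A(c) → 1 + 1/q - D. Opening all leaves costs L, so the ratio
--     tends to (1 + q)/q as D → 0 and L → ∞.
-- Whether 2 ≥ 1/q is undecidable for a real q, but for D = 1/k comparing an
-- approximation of q within D to ½ selects a family whose ratio misses the
-- maximum by O(1/k).
module Submission where

import Data.Integer.Base as ℤ
import Data.Integer.Properties as ℤ
open import Data.List.Base as List using (List; []; _∷_; _++_; length; concatMap; replicate)
open import Data.List.Membership.Propositional using (_∈_)
open import Data.List.NonEmpty.Base using (List⁺; _∷_; _∷⁺_; toList)
import Data.List.Properties as List
open import Data.List.Relation.Binary.Permutation.Propositional
  using (_↭_; prep; swap; ↭-refl; ↭-sym; ↭-trans)
open import Data.List.Relation.Binary.Permutation.Propositional.Properties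
  using (map⁺; All-resp-↭; ¬x∷xs↭[]; ↭-length)
open import Data.List.Relation.Unary.All as All using (All; []; _∷_)
import Data.List.Relation.Unary.All.Properties as All
open import Data.List.Relation.Unary.AllPairs using ([]; _∷_)
open import Data.List.Relation.Unary.Any using (here; there)
open import Data.List.Relation.Unary.Unique.Propositional using (Unique)
import Data.List.Relation.Unary.Unique.Propositional.Properties as Unique
open import Data.Nat.Base as ℕ using (ℕ; zero; suc; _!)
open import Data.Nat.ListAction using (sum)
open import Data.Nat.ListAction.Properties using (sum-++; sum-↭)
import Data.Nat.Properties as ℕ
open import Data.Product using (Σ-syntax; ∃-syntax; _×_; _,_; proj₁; proj₂)
import Data.Rational.Base as ℚ
import Data.Rational.Properties as ℚ
import Data.Rational.Unnormalised.Base as ℚᵘ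
import Data.Rational.Unnormalised.Properties as ℚᵘ
open import Data.Sum.Base using (_⊎_; inj₁; inj₂; [_,_]′)
open import Function.Base using (_∘_)
open import Relation.Binary.PropositionalEquality
  using (_≡_; _≢_; refl; sym; trans; cong; cong₂; subst; subst₂; isEquivalence; module ≡-Reasoning)
open import Relation.Binary.Structures using (IsPartialOrder)
open import Relation.Nullary.Decidable using (Dec; yes; no; from-yes)
open import Relation.Nullary.Negation using (contradiction)
import Defs
open import Defs hiding (_≤_; _<_; _≈_; _+_; _*_; -_; _-_; _⊓_; _⊔_; sum; ≤-trans; 0≤+)

-- Order and arithmetic of the rationals.

module RationalArithmetic where
  open import Data.Rational.Base
  open import Data.Rational.Solver using (module +-*-Solver)
  open +-*-Solver

  ι : ℕ → ℚ
  ι n = ℤ.+ n / 1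

  ι-+ : ∀ m n → ι (m ℕ.+ n) ≡ ι m + ι n
  ι-+ m n = ℚ.toℚᵘ-injective (begin
    toℚᵘ (ι (m ℕ.+ n))           ≈⟨ ℚ.toℚᵘ-fromℚᵘ _ ⟩
    ℚᵘ.mkℚᵘ (ℤ.+ (m ℕ.+ n)) 0
      ≈⟨ ℚᵘ.*≡* (cong (ℤ._* ℤ.+ 1) (sym (cong₂ ℤ._+_ (ℤ.*-identityʳ (ℤ.+ m)) (ℤ.*-identityʳ (ℤ.+ n))))) ⟩
    ℚᵘ.mkℚᵘ (ℤ.+ m) 0 ℚᵘ.+ ℚᵘ.mkℚᵘ (ℤ.+ n) 0
      ≈⟨ ℚᵘ.+-cong (ℚᵘ.≃-sym (ℚ.toℚᵘ-fromℚᵘ (ℚᵘ.mkℚᵘ (ℤ.+ m) 0)))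
           (ℚᵘ.≃-sym (ℚ.toℚᵘ-fromℚᵘ (ℚᵘ.mkℚᵘ (ℤ.+ n) 0))) ⟩
    toℚᵘ (ι m) ℚᵘ.+ toℚᵘ (ι n)   ≈⟨ ℚ.toℚᵘ-homo-+ (ι m) (ι n) ⟨
    toℚᵘ (ι m + ι n)             ∎)
    where open ℚᵘ.≃-Reasoning

  ι-suc : ∀ n → ι (suc n) ≡ 1ℚ + ι n
  ι-suc = ι-+ 1

  ι-* : ∀ m n → ι (m ℕ.* n) ≡ ι m * ι n
  ι-* zero    n = sym (ℚ.*-zeroˡ (ι n))
  ι-* (suc m) n = begin
    ι (n ℕ.+ m ℕ.* n)  ≡⟨ ι-+ n (m ℕ.* n) ⟩
    ι n + ι (m ℕ.* n)  ≡⟨ cong (ι n +_) (ι-* m n) ⟩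
    ι n + ι m * ι n    ≡⟨ solve 2 (λ a b → b :+ a :* b := (con 1ℚ :+ a) :* b) refl (ι m) (ι n) ⟩
    (1ℚ + ι m) * ι n   ≡⟨ cong (_* ι n) (ι-suc m) ⟨
    ι (suc m) * ι n    ∎
    where open ≡-Reasoning

  -- Most inequalities below are proved by exhibiting the slack `s` explicitly: its sign is read off
  -- from a sum of products of nonnegative factors, and the equation is left to the ring solver.
  ≤-gap : ∀ {p q} s → 0ℚ ≤ s → q ≡ p + s → p ≤ q
  ≤-gap {p} s 0≤s refl = subst (_≤ p + s) (ℚ.+-identityʳ p) (ℚ.+-monoʳ-≤ p 0≤s)

  -- For identities that hold modulo the relations u = 1 and v = 1.
  ≤-gap-mod : ∀ {p q u v} s a b → 0ℚ ≤ s → u ≡ 1ℚ → v ≡ 1ℚ →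
    q ≡ p + s + a * (u - 1ℚ) + b * (v - 1ℚ) → p ≤ q
  ≤-gap-mod {p} s a b 0≤s refl refl q≡ = ≤-gap s 0≤s (trans q≡
    (solve 4 (λ p s a b → p :+ s :+ a :* (con 1ℚ :- con 1ℚ) :+ b :* (con 1ℚ :- con 1ℚ) := p :+ s) refl
      p s a b))

  0≤q-p : ∀ {p q} → p ≤ q → 0ℚ ≤ q - p
  0≤q-p {p} {q} p≤q = subst (_≤ q - p) (ℚ.+-inverseʳ p) (ℚ.+-monoˡ-≤ (- p) p≤q)

  0≤+ : ∀ {p q} → 0ℚ ≤ p → 0ℚ ≤ q → 0ℚ ≤ p + q
  0≤+ = ℚ.+-mono-≤

  0≤* : ∀ {p q} → 0ℚ ≤ p → 0ℚ ≤ q → 0ℚ ≤ p * q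
  0≤* {p} {q} 0≤p 0≤q = ℚ.nonNegative⁻¹ (p * q)
    {{ℚ.nonNeg*nonNeg⇒nonNeg p {{nonNegative 0≤p}} q {{nonNegative 0≤q}}}}

  0≤p*p : ∀ p → 0ℚ ≤ p * p
  0≤p*p p with ℚ.≤-total 0ℚ p
  ... | inj₁ 0≤p = 0≤* 0≤p 0≤p
  ... | inj₂ p≤0 = subst (0ℚ ≤_) (solve 1 (λ p → :- p :* :- p := p :* p) refl p)
    (0≤* (ℚ.neg-antimono-≤ p≤0) (ℚ.neg-antimono-≤ p≤0))

  0≤1 : 0ℚ ≤ 1ℚ
  0≤1 = ℚ.nonNegative⁻¹ 1ℚ

  0≤ι : ∀ n → 0ℚ ≤ ι n
  0≤ι zero    = ℚ.≤-refl
  0≤ι (suc n) = subst (0ℚ ≤_) (sym (ι-suc n)) (0≤+ 0≤1 (0≤ι n))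

  ι-mono-≤ : ∀ {m n} → m ℕ.≤ n → ι m ≤ ι n
  ι-mono-≤ {m} {n} m≤n = ≤-gap (ι (n ℕ.∸ m)) (0≤ι (n ℕ.∸ m))
    (trans (cong ι (sym (ℕ.m+[n∸m]≡n m≤n))) (ι-+ m (n ℕ.∸ m)))

  ι-*-inverse : ∀ n .{{_ : ℕ.NonZero n}} → ι n * (ℤ.+ 1 / n) ≡ 1ℚ
  ι-*-inverse n@(suc k) = ℚ.toℚᵘ-injective (begin
    toℚᵘ (ι n * (ℤ.+ 1 / n))                   ≈⟨ ℚ.toℚᵘ-homo-* (ι n) (ℤ.+ 1 / n) ⟩
    toℚᵘ (ι n) ℚᵘ.* toℚᵘ (ℤ.+ 1 / n)
      ≈⟨ ℚᵘ.*-cong (ℚ.toℚᵘ-fromℚᵘ (ℚᵘ.mkℚᵘ (ℤ.+ n) 0))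
           (ℚ.toℚᵘ-fromℚᵘ (ℚᵘ.mkℚᵘ (ℤ.+ 1) k)) ⟩
    ℚᵘ.mkℚᵘ (ℤ.+ n) 0 ℚᵘ.* ℚᵘ.mkℚᵘ (ℤ.+ 1) k     ≈⟨ ℚᵘ.*≡* (trans (ℤ.*-identityʳ _) (trans (ℤ.*-identityʳ _)
        (sym (trans (ℤ.*-identityˡ _) (cong ℤ.+_ (ℕ.*-identityˡ n)))))) ⟩
    toℚᵘ 1ℚ                                  ∎)
    where open ℚᵘ.≃-Reasoning

  -- The denominator is a witness: multiplying by it leaves the numerator, a positive integer.
  archimedean : ∀ p → 0ℚ < p → ∃[ n ] 1ℚ ≤ ι n * p
  archimedean p@(mkℚ (ℤ.+ suc a) b _) _ = suc b , ℚ.toℚᵘ-cancel-≤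
    (ℚᵘ.≤-respʳ-≃
      (ℚᵘ.≃-sym (ℚᵘ.≃-trans (ℚ.toℚᵘ-homo-* (ι (suc b)) p)
        (ℚᵘ.*-congʳ (ℚ.toℚᵘ-fromℚᵘ (ℚᵘ.mkℚᵘ (ℤ.+ suc b) 0)))))
      (ℚᵘ.*≤* (ℤ.+≤+ lem)))
    where
    lem : 1 ℕ.* (1 ℕ.* suc b) ℕ.≤ suc b ℕ.* suc a ℕ.* 1
    lem = ℕ.≤-trans (ℕ.≤-reflexive (trans (ℕ.*-identityˡ _) (ℕ.*-identityˡ _)))
      (ℕ.≤-trans (ℕ.m≤m*n (suc b) (suc a)) (ℕ.≤-reflexive (sym (ℕ.*-identityʳ _))))
  archimedean (mkℚ (ℤ.+ zero) b _) (*<* (ℤ.+<+ ()))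
  archimedean (mkℚ ℤ.-[1+ a ] b _) (*<* ())

-- Finite sums of rationals.

module Sums {A : Set} where
  open import Data.Rational.Base
  open import Data.Rational.Solver using (module +-*-Solver)
  open +-*-Solver
  open RationalArithmetic

  ∑ : (A → ℚ) → List A → ℚ
  ∑ f []       = 0ℚ
  ∑ f (u ∷ us) = f u + ∑ f us

  ∑-cong : ∀ {f g} us → (∀ {u} → u ∈ us → f u ≡ g u) → ∑ f us ≡ ∑ g us
  ∑-cong []       f≡g = refl
  ∑-cong (u ∷ us) f≡g = cong₂ _+_ (f≡g (here refl)) (∑-cong us (f≡g ∘ there))

  ∑-mono : ∀ {f g} us → (∀ {u} → u ∈ us → f u ≤ g u) → ∑ f us ≤ ∑ g us
  ∑-mono []       f≤g = ℚ.≤-refl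
  ∑-mono (u ∷ us) f≤g = ℚ.+-mono-≤ (f≤g (here refl)) (∑-mono us (f≤g ∘ there))

  ∑-distribˡ : ∀ p f us → ∑ (λ u → p * f u) us ≡ p * ∑ f us
  ∑-distribˡ p f []       = sym (ℚ.*-zeroʳ p)
  ∑-distribˡ p f (u ∷ us) = trans (cong (p * f u +_) (∑-distribˡ p f us))
    (sym (ℚ.*-distribˡ-+ p (f u) (∑ f us)))

  ∑-distrib-+ : ∀ f g us → ∑ (λ u → f u + g u) us ≡ ∑ f us + ∑ g us
  ∑-distrib-+ f g []       = refl
  ∑-distrib-+ f g (u ∷ us) = trans (cong (f u + g u +_) (∑-distrib-+ f g us))
    (solve 4 (λ a b c d → a :+ b :+ (c :+ d) := a :+ c :+ (b :+ d)) refl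
      (f u) (g u) (∑ f us) (∑ g us))

  ∑-const : ∀ p us → ∑ (λ _ → p) us ≡ ι (length us) * p
  ∑-const p []       = sym (ℚ.*-zeroˡ p)
  ∑-const p (u ∷ us) = begin
    p + ∑ (λ _ → p) us         ≡⟨ cong (p +_) (∑-const p us) ⟩
    p + ι (length us) * p      ≡⟨ solve 2 (λ p n → p :+ n :* p := (con 1ℚ :+ n) :* p) refl p (ι (length us)) ⟩
    (1ℚ + ι (length us)) * p   ≡⟨ cong (_* p) (ι-suc (length us)) ⟨
    ι (suc (length us)) * p    ∎
    where open ≡-Reasoning

  ∑-++ : ∀ f us vs → ∑ f (us ++ vs) ≡ ∑ f us + ∑ f vs
  ∑-++ f []       vs = sym (ℚ.+-identityˡ (∑ f vs))
  ∑-++ f (u ∷ us) vs = trans (cong (f u +_) (∑-++ f us vs))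
    (sym (ℚ.+-assoc (f u) (∑ f us) (∑ f vs)))

  -- Since `v` occurs exactly once in `us`, the surplus `b` at `v` enters the sum exactly once. This
  -- isolates the one leaf that an arriving demand affects.
  ∑-update : ∀ {f g : A → ℚ} {us v} b → Unique us → v ∈ us →
    (∀ {u} → u ∈ us → u ≢ v → f u ≡ g u) → f v ≡ g v + b → ∑ f us ≡ ∑ g us + b
  ∑-update {f} {g} {v ∷ us} b (v∉us ∷ _) (here refl) f≡g fv≡ =
    trans (cong₂ _+_ fv≡ (∑-cong us λ u∈us → f≡g (there u∈us) (All.lookup v∉us u∈us ∘ sym)))
      (solve 3 (λ a b c → a :+ b :+ c := a :+ c :+ b) refl (g v) b (∑ g us))
  ∑-update {f} {g} {u ∷ us} {v} b (u∉us ∷ us!) (there v∈us) f≡g fv≡ =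
    trans (cong₂ _+_ (f≡g (here refl) (All.lookup u∉us v∈us))
      (∑-update b us! v∈us (f≡g ∘ there) fv≡))
      (sym (ℚ.+-assoc (g u) (∑ g us) b))

-- Expectations, and averages over the arrival order.

module Expectation where
  open import Data.Rational.Base
  open import Data.Rational.Solver using (module +-*-Solver)
  open +-*-Solver
  open RationalArithmetic
  open Sums

  ∑-map : ∀ {A B : Set} (f : B → ℚ) (g : A → B) us → ∑ f (List.map g us) ≡ ∑ (f ∘ g) us
  ∑-map f g []       = refl
  ∑-map f g (u ∷ us) = cong (f (g u) +_) (∑-map f g us)

  -- The operations on `ℝ` act term by term, so expected costs are computed at a fixed index `n` of
  -- the Cauchy sequences, where all identities are identities of rationals.
  𝔼 : ℕ → {A : Set} → Dist A → (A → ℚ) → ℚ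
  𝔼 n μ g = ∑ (λ (w , a) → seq w n * g a) μ

  𝔼->>= : ∀ n {A B : Set} (μ : Dist A) (f : A → Dist B) g →
    𝔼 n (μ >>= f) g ≡ 𝔼 n μ (λ a → 𝔼 n (f a) g)
  𝔼->>= n []            f g = refl
  𝔼->>= n ((w , a) ∷ μ) f g =
    trans (∑-++ _ (List.map _ (f a)) (μ >>= f)) (cong₂ _+_ scaled (𝔼->>= n μ f g))
    where
    open ≡-Reasoning
    scaled : 𝔼 n (List.map _ (f a)) g ≡ seq w n * 𝔼 n (f a) g
    scaled = begin
      𝔼 n (List.map _ (f a)) g
        ≡⟨ ∑-map _ _ (f a) ⟩
      ∑ (λ (w′ , b) → seq w n * seq w′ n * g b) (f a)
        ≡⟨ ∑-cong (f a) (λ {(w′ , b)} _ → ℚ.*-assoc (seq w n) (seq w′ n) (g b)) ⟩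
      ∑ (λ (w′ , b) → seq w n * (seq w′ n * g b)) (f a)
        ≡⟨ ∑-distribˡ (seq w n) _ (f a) ⟩
      seq w n * 𝔼 n (f a) g ∎

  𝔼-point : ∀ n {A : Set} (a : A) g → 𝔼 n (point a) g ≡ g a
  𝔼-point n a g = solve 1 (λ x → con 1ℚ :* x :+ con 0ℚ := x) refl (g a)

  E-seq : ∀ n μ → seq (E μ) n ≡ 𝔼 n μ (λ c → seq c n)
  E-seq n []            = refl
  E-seq n ((w , c) ∷ μ) = cong (seq w n * seq c n +_) (E-seq n μ)

  length-concatMap : ∀ {A B : Set} (f : A → List B) k xs →
    All (λ x → length (f x) ≡ k) xs → length (concatMap f xs) ≡ length xs ℕ.* k
  length-concatMap f k []       []       = refl
  length-concatMap f k (x ∷ xs) (p ∷ ps) =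
    trans (List.length-++ (f x)) (cong₂ ℕ._+_ p (length-concatMap f k xs ps))

  insertions-↭ : ∀ {A : Set} (x : A) ys → All (_↭ x ∷ ys) (insertions x ys)
  insertions-↭ x []       = ↭-refl ∷ []
  insertions-↭ x (y ∷ ys) = ↭-refl ∷ All.map⁺ (All.map
    (λ zs↭ → ↭-trans (prep y zs↭) (swap y x ↭-refl)) (insertions-↭ x ys))

  permutations-↭ : ∀ {A : Set} (xs : List A) → All (_↭ xs) (permutations xs)
  permutations-↭ []       = ↭-refl ∷ []
  permutations-↭ (x ∷ xs) = All.concat⁺ (All.map⁺ (All.map
    (λ {ys} ys↭xs → All.map (λ zs↭ → ↭-trans zs↭ (prep x ys↭xs)) (insertions-↭ x ys))
    (permutations-↭ xs)))

  length-insertions : ∀ {A : Set} (x : A) ys → length (insertions x ys) ≡ suc (length ys)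
  length-insertions x []       = refl
  length-insertions x (y ∷ ys) = cong suc
    (trans (List.length-map (y ∷_) (insertions x ys)) (length-insertions x ys))

  length-permutations : ∀ {A : Set} (xs : List A) → length (permutations xs) ≡ length xs !
  length-permutations []       = refl
  length-permutations (x ∷ xs) = begin
    length (concatMap (insertions x) (permutations xs))
      ≡⟨ length-concatMap (insertions x) (suc (length xs)) (permutations xs) (All.map
           (λ {ys} ys↭xs → trans (length-insertions x ys) (cong suc (↭-length ys↭xs)))
           (permutations-↭ xs)) ⟩
    length (permutations xs) ℕ.* suc (length xs)
      ≡⟨ cong (ℕ._* suc (length xs)) (length-permutations xs) ⟩
    length xs ! ℕ.* suc (length xs)
      ≡⟨ ℕ.*-comm (length xs !) (suc (length xs)) ⟩
    suc (length xs) ! ∎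
    where open ≡-Reasoning

  -- Every listed order is a rearrangement of `xs`, and there are `length xs !` of them, so the
  -- weights add up to 1. An expected cost that is the same for all orders is thus the expected cost
  -- in the random-order model.
  𝔼-randomOrder-const : ∀ n {A : Set} (xs : List A) g {p} →
    (∀ {ys} → ys ↭ xs → g ys ≡ p) → 𝔼 n (randomOrder xs) g ≡ p
  𝔼-randomOrder-const n xs g {p} g≡p = begin
    𝔼 n (randomOrder xs) g
      ≡⟨ ∑-map _ _ (permutations xs) ⟩
    ∑ (λ ys → m⁻¹ * g ys) (permutations xs)
      ≡⟨ ∑-cong (permutations xs) (λ ys∈ → cong (m⁻¹ *_) (g≡p (All.lookup (permutations-↭ xs) ys∈))) ⟩
    ∑ (λ _ → m⁻¹ * p) (permutations xs)
      ≡⟨ ∑-const (m⁻¹ * p) (permutations xs) ⟩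
    ι (length (permutations xs)) * (m⁻¹ * p)
      ≡⟨ cong (λ k → ι k * (m⁻¹ * p)) (length-permutations xs) ⟩
    ι (length xs !) * (m⁻¹ * p)
      ≡⟨ ℚ.*-assoc (ι (length xs !)) m⁻¹ p ⟨
    ι (length xs !) * m⁻¹ * p
      ≡⟨ cong (_* p) (ι-*-inverse (length xs !) {{ℕ._!≢0 (length xs)}}) ⟩
    1ℚ * p
      ≡⟨ ℚ.*-identityˡ p ⟩
    p ∎
    where
    open ≡-Reasoning
    m⁻¹ : ℚ
    m⁻¹ = _/_ (ℤ.+ 1) (length xs !) {{ℕ._!≢0 (length xs)}}

-- Recursion for the expected cost of a run in an arbitrary metric space.

module Execution (S : MetricSpace) (q : ℝ) (n : ℕ) where
  open import Data.Rational.Base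
  open import Data.Rational.Solver using (module +-*-Solver)
  open +-*-Solver
  open RationalArithmetic
  open Sums
  open Expectation
  open MetricSpace S

  dist : List⁺ Point → Point → ℚ
  dist F v = seq (distance S F v) n

  𝔼-step : ∀ f F v g → 𝔼 n (step S q (f ∷ F) v) g ≡
    ((seq q n * dist (f ∷ F) v) ⊓ 1ℚ) * g (v ∷⁺ f ∷ F) +
    (1ℚ - (seq q n * dist (f ∷ F) v) ⊓ 1ℚ) * g (f ∷ F)
  𝔼-step f F v g = solve 3
    (λ p x y → p :* con 1ℚ :* x :+ ((con 1ℚ :- p) :* con 1ℚ :* y :+ con 0ℚ) :=
      p :* x :+ (con 1ℚ :- p) :* y) refl
    ((seq q n * dist (f ∷ F) v) ⊓ 1ℚ) (g (v ∷⁺ f ∷ F)) (g (f ∷ F))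

  𝔼-step-1 : ∀ F v → 𝔼 n (step S q F v) (λ _ → 1ℚ) ≡ 1ℚ
  𝔼-step-1 []      v = refl
  𝔼-step-1 (f ∷ F) v = trans (𝔼-step f F v (λ _ → 1ℚ))
    (solve 1 (λ p → p :* con 1ℚ :+ (con 1ℚ :- p) :* con 1ℚ := con 1ℚ) refl
      ((seq q n * dist (f ∷ F) v) ⊓ 1ℚ))

  𝔼-cong : ∀ {A : Set} (μ : Dist A) {g h} → (∀ a → g a ≡ h a) → 𝔼 n μ g ≡ 𝔼 n μ h
  𝔼-cong μ g≡h = ∑-cong μ (λ {(w , a)} _ → cong (seq w n *_) (g≡h a))

  𝔼-run-∷ : ∀ F v vs g → 𝔼 n (run S q F (v ∷ vs)) g ≡
    𝔼 n (step S q F v) (λ F′ → 𝔼 n (run S q (toList F′) vs) (λ c → g (distance S F′ v Defs.+ c)))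
  𝔼-run-∷ F v vs g = trans (𝔼->>= n (step S q F v) rest g) (𝔼-cong (step S q F v) λ F′ → trans
    (𝔼->>= n (run S q (toList F′) vs) (λ c → point (distance S F′ v Defs.+ c)) g)
    (𝔼-cong (run S q (toList F′) vs) λ c → 𝔼-point n (distance S F′ v Defs.+ c) g))
    where
    rest : List⁺ Point → Dist ℝ
    rest F′ = run S q (toList F′) vs >>= λ c → point (distance S F′ v Defs.+ c)

  -- The weights of each coin are `p` and `1 - p` at every index, so the total mass is exactly 1 and
  -- not merely in the limit. `𝔼-+-run` uses this to move a distance already paid out of the
  -- expectation.
  𝔼-run-1 : ∀ F vs → 𝔼 n (run S q F vs) (λ _ → 1ℚ) ≡ 1ℚ
  𝔼-run-1 F []       = refl
  𝔼-run-1 F (v ∷ vs) = trans (𝔼-run-∷ F v vs (λ _ → 1ℚ)) (trans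
    (𝔼-cong (step S q F v) (λ F′ → 𝔼-run-1 (toList F′) vs))
    (𝔼-step-1 F v))

  abstract
    -- Later arguments reach this value only through `runCost-first`, `runCost-next`, `runCost-[]`
    -- and `E-randomOrder-run`, so the weighted list of outcomes is not unfolded again.
    runCost : List Point → List Point → ℚ
    runCost F vs = 𝔼 n (run S q F vs) (λ c → seq c n)

    𝔼-+-run : ∀ p F vs → 𝔼 n (run S q F vs) (λ c → p + seq c n) ≡ p + runCost F vs
    𝔼-+-run p F vs = begin
      𝔼 n μ (λ c → p + seq c n)
        ≡⟨ ∑-cong μ (λ {(w , c)} _ → solve 3 (λ w p c → w :* (p :+ c) := p :* (w :* con 1ℚ) :+ w :* c) refl
           (seq w n) p (seq c n)) ⟩
      ∑ (λ (w , c) → p * (seq w n * 1ℚ) + seq w n * seq c n) μ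
        ≡⟨ ∑-distrib-+ _ _ μ ⟩
      ∑ (λ (w , c) → p * (seq w n * 1ℚ)) μ + runCost F vs
        ≡⟨ cong (_+ runCost F vs) (∑-distribˡ p _ μ) ⟩
      p * 𝔼 n μ (λ _ → 1ℚ) + runCost F vs
        ≡⟨ cong (λ m → p * m + runCost F vs) (𝔼-run-1 F vs) ⟩
      p * 1ℚ + runCost F vs
        ≡⟨ cong (_+ runCost F vs) (ℚ.*-identityʳ p) ⟩
      p + runCost F vs ∎
      where
      open ≡-Reasoning
      μ : Dist ℝ
      μ = run S q F vs

    runCost-∷ : ∀ F v vs → runCost F (v ∷ vs) ≡
      𝔼 n (step S q F v) (λ F′ → dist F′ v + runCost (toList F′) vs)
    runCost-∷ F v vs = trans (𝔼-run-∷ F v vs (λ c → seq c n))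
      (𝔼-cong (step S q F v) λ F′ → 𝔼-+-run (dist F′ v) (toList F′) vs)

    runCost-first : ∀ v vs → runCost [] (v ∷ vs) ≡ dist (v ∷ []) v + runCost (v ∷ []) vs
    runCost-first v vs = trans (runCost-∷ [] v vs)
      (𝔼-point n (v ∷ []) (λ F′ → dist F′ v + runCost (toList F′) vs))

    runCost-next : ∀ f F v vs → let p = (seq q n * dist (f ∷ F) v) ⊓ 1ℚ in
      runCost (f ∷ F) (v ∷ vs) ≡
      p * (dist (v ∷⁺ f ∷ F) v + runCost (v ∷ f ∷ F) vs) +
      (1ℚ - p) * (dist (f ∷ F) v + runCost (f ∷ F) vs)
    runCost-next f F v vs = trans (runCost-∷ (f ∷ F) v vs)
      (𝔼-step f F v (λ F′ → dist F′ v + runCost (toList F′) vs))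

    runCost-[] : ∀ F → runCost F [] ≡ ι (length F)
    runCost-[] F = 𝔼-point n (fromℕ (length F)) (λ c → seq c n)

    E-randomOrder-run : ∀ vs →
      seq (E (randomOrder vs >>= run S q [])) n ≡ 𝔼 n (randomOrder vs) (runCost [])
    E-randomOrder-run vs = trans (E-seq n (randomOrder vs >>= run S q []))
      (𝔼->>= n (randomOrder vs) (run S q []) (λ c → seq c n))

-- Order on the reals from the terms of their sequences.

module RealOrder where
  open import Data.Rational.Base
  open RationalArithmetic

  eventually-≤ : ∀ {x y} → (∃[ N ] ∀ n → N ℕ.≤ n → seq x n ≤ seq y n) → x Defs.≤ y
  eventually-≤ {x} {y} (N , x≤y) ε 0<ε = N , λ n N≤n →
    ℚ.≤-trans (x≤y n N≤n) (≤-gap ε (ℚ.<⇒≤ 0<ε) refl)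

  termwise-≤ : ∀ {x y} → (∀ n → seq x n ≤ seq y n) → x Defs.≤ y
  termwise-≤ {x} {y} x≤y = eventually-≤ {x} {y} (0 , λ n _ → x≤y n)

  termwise-≈ : ∀ {x y} → (∀ n → seq x n ≡ seq y n) → x Defs.≈ y
  termwise-≈ {x} {y} x≡y = termwise-≤ {x} {y} (λ n → ℚ.≤-reflexive (x≡y n)) ,
    termwise-≤ {y} {x} (λ n → ℚ.≤-reflexive (sym (x≡y n)))

  ≈-sym : ∀ {x y} → x Defs.≈ y → y Defs.≈ x
  ≈-sym (x≤y , y≤x) = y≤x , x≤y

  ≈-trans : ∀ {x y z} → x Defs.≈ y → y Defs.≈ z → x Defs.≈ z
  ≈-trans {x} {y} {z} (x≤y , y≤x) (y≤z , z≤y) =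
    Defs.≤-trans {x} {y} {z} x≤y y≤z , Defs.≤-trans {z} {y} {x} z≤y y≤x

  isPartialOrder : IsPartialOrder Defs._≈_ Defs._≤_
  isPartialOrder = record
    { isPreorder = record
      { isEquivalence = record
        { refl  = λ {x} → termwise-≈ {x} {x} (λ _ → refl)
        ; sym   = λ {x} {y} → ≈-sym {x} {y}
        ; trans = λ {x} {y} {z} → ≈-trans {x} {y} {z}
        }
      ; reflexive = proj₁
      ; trans     = λ {x} {y} {z} → Defs.≤-trans {x} {y} {z}
      }
    ; antisym = _,_
    }

-- The star metric.

module Star (r : ℚ.ℚ) (0<r : ℚ.0ℚ ℚ.< r) where
  open import Data.Rational.Base
  open import Data.Rational.Solver using (module +-*-Solver)
  open +-*-Solver
  open RationalArithmetic
  open RealOrder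

  0≤r : 0ℚ ≤ r
  0≤r = ℚ.<⇒≤ 0<r

  -- The centre of the star is 0 and its leaves are the positive numbers.
  radius : ℕ → ℚ
  radius zero    = 0ℚ
  radius (suc _) = r

  0≤radius : ∀ x → 0ℚ ≤ radius x
  0≤radius zero    = ℚ.≤-refl
  0≤radius (suc _) = 0≤r

  d★ : ℕ → ℕ → ℚ
  d★ x y with x ℕ.≟ y
  ... | yes _ = 0ℚ
  ... | no  _ = radius x + radius y

  d★-refl : ∀ x → d★ x x ≡ 0ℚ
  d★-refl x with x ℕ.≟ x
  ... | yes _   = refl
  ... | no  x≢x = contradiction refl x≢x

  d★-≢ : ∀ {x y} → x ≢ y → d★ x y ≡ radius x + radius y
  d★-≢ {x} {y} x≢y with x ℕ.≟ y
  ... | yes x≡y = contradiction x≡y x≢y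
  ... | no  _   = refl

  d★-sym : ∀ x y → d★ x y ≡ d★ y x
  d★-sym x y with x ℕ.≟ y
  ... | yes refl = sym (d★-refl x)
  ... | no  x≢y  = trans (ℚ.+-comm (radius x) (radius y)) (sym (d★-≢ (x≢y ∘ sym)))

  0≤d★ : ∀ x y → 0ℚ ≤ d★ x y
  0≤d★ x y with x ℕ.≟ y
  ... | yes _ = ℚ.≤-refl
  ... | no  _ = 0≤+ (0≤radius x) (0≤radius y)

  r≤d★ : ∀ {x y} → x ≢ y → r ≤ d★ x y
  r≤d★ {zero}  {zero}  x≢y = contradiction refl x≢y
  r≤d★ {zero}  {suc y} x≢y = ℚ.≤-reflexive (sym (trans (d★-≢ x≢y) (ℚ.+-identityˡ r)))
  r≤d★ {suc x} {y}     x≢y = ≤-gap (radius y) (0≤radius y) (d★-≢ x≢y)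

  d★≤radii : ∀ x y → d★ x y ≤ radius x + radius y
  d★≤radii x y with x ℕ.≟ y
  ... | yes _ = 0≤+ (0≤radius x) (0≤radius y)
  ... | no  _ = ℚ.≤-refl

  -- If `y` is an endpoint, one summand on the right is the left side itself. Otherwise the detour
  -- through `y` exceeds the sum of the outer radii by twice the radius of `y`.
  d★-triangle : ∀ x y z → d★ x z ≤ d★ x y + d★ y z
  d★-triangle x y z = go (x ℕ.≟ y) (y ℕ.≟ z)
    where
    go : Dec (x ≡ y) → Dec (y ≡ z) → d★ x z ≤ d★ x y + d★ y z
    go (yes refl) _          = ≤-gap (d★ x x) (0≤d★ x x) (ℚ.+-comm (d★ x x) (d★ x z))
    go (no _)     (yes refl) = ≤-gap (d★ y y) (0≤d★ y y) refl
    go (no x≢y)   (no y≢z)   = ℚ.≤-trans (d★≤radii x z)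
      (≤-gap (radius y + radius y) (0≤+ (0≤radius y) (0≤radius y))
        (trans (cong₂ _+_ (d★-≢ x≢y) (d★-≢ y≢z))
          (solve 3 (λ a b c → a :+ b :+ (b :+ c) := a :+ c :+ (b :+ b)) refl
            (radius x) (radius y) (radius z))))

  star : MetricSpace
  star = record
    { Point    = ℕ
    ; d        = λ x y → fromℚ (d★ x y)
    ; isMetric = record
      { isSemiMetric = record
        { isQuasiSemiMetric = record
          { isPreMetric = record
            { isProtoMetric = record
              { isPartialOrder  = isPartialOrder
              ; ≈-isEquivalence = isEquivalence
              ; cong            = λ { {x} {_} {y} refl refl →
                  termwise-≈ {fromℚ (d★ x y)} {fromℚ (d★ x y)} (λ _ → refl) }
              ; nonNegative     = λ {x} {y} → termwise-≤ {0ℝ} {fromℚ (d★ x y)} (λ _ → 0≤d★ x y)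
              }
            ; ≈⇒0 = λ { {x} refl → termwise-≈ {fromℚ (d★ x x)} {0ℝ} (λ _ → d★-refl x) }
            }
          ; 0⇒≈ = λ {x} {y} → 0⇒≡ x y
          }
        ; sym = λ x y → termwise-≈ {fromℚ (d★ x y)} {fromℚ (d★ y x)} (λ _ → d★-sym x y)
        }
      ; triangle = λ x y z → termwise-≤ {fromℚ (d★ x z)}
          {fromℚ (d★ x y) Defs.+ fromℚ (d★ y z)} (λ _ → d★-triangle x y z)
      }
    }
    where
    0⇒≡ : ∀ x y → fromℚ (d★ x y) Defs.≈ 0ℝ → x ≡ y
    0⇒≡ x y (d≤0 , _) with x ℕ.≟ y
    ... | yes x≡y = x≡y
    ... | no  x≢y = contradiction r<r (ℚ.<-irrefl refl)
      where
      0<½r : 0ℚ < ½ * r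
      0<½r = ℚ.positive⁻¹ (½ * r) {{ℚ.pos*pos⇒pos ½ r {{positive 0<r}}}}
      -- Being at most 0 as a real means being bounded by every positive rational. The bound `½ * r`
      -- contradicts the separation of distinct points by `r`.
      r≤½r : r ≤ ½ * r
      r≤½r = subst (r ≤_) (ℚ.+-identityˡ (½ * r)) (ℚ.≤-trans (subst (r ≤_) (d★-≢ x≢y) (r≤d★ x≢y))
        (proj₂ (d≤0 (½ * r) 0<½r) _ ℕ.≤-refl))
      r<r : r < r
      r<r = ℚ.≤-<-trans r≤½r (subst (½ * r <_)
        (solve 1 (λ r → con ½ :* r :+ con ½ :* r := r) refl r)
        (subst (_< ½ * r + ½ * r) (ℚ.+-identityʳ (½ * r)) (ℚ.+-monoʳ-< (½ * r) 0<½r)))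

-- Counting the points at which no facility is open.

module Facilities where
  open import Data.Rational.Base
  open import Data.Rational.Solver using (module +-*-Solver)
  open +-*-Solver
  open RationalArithmetic
  open Sums

  -- An indicator with rational values, so that it can be a factor in the polynomial identities for
  -- distances and costs.
  miss : List ℕ → ℕ → ℚ
  miss []      v = 1ℚ
  miss (f ∷ F) v with f ℕ.≟ v
  ... | yes _ = 0ℚ
  ... | no  _ = miss F v

  miss-here : ∀ F v → miss (v ∷ F) v ≡ 0ℚ
  miss-here F v with v ℕ.≟ v
  ... | yes _   = refl
  ... | no  v≢v = contradiction refl v≢v

  miss-skip : ∀ {f v} F → f ≢ v → miss (f ∷ F) v ≡ miss F v
  miss-skip {f} {v} F f≢v with f ℕ.≟ v
  ... | yes f≡v = contradiction f≡v f≢v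
  ... | no  _   = refl

  miss-0∨1 : ∀ F v → miss F v ≡ 0ℚ ⊎ miss F v ≡ 1ℚ
  miss-0∨1 []      v = inj₂ refl
  miss-0∨1 (f ∷ F) v with f ℕ.≟ v
  ... | yes _ = inj₁ refl
  ... | no  _ = miss-0∨1 F v

  0≤miss : ∀ F v → 0ℚ ≤ miss F v
  0≤miss F v with miss-0∨1 F v
  ... | inj₁ m≡0 = ℚ.≤-reflexive (sym m≡0)
  ... | inj₂ m≡1 = subst (0ℚ ≤_) (sym m≡1) 0≤1

  miss≤1 : ∀ F v → miss F v ≤ 1ℚ
  miss≤1 F v with miss-0∨1 F v
  ... | inj₁ m≡0 = subst (_≤ 1ℚ) (sym m≡0) 0≤1
  ... | inj₂ m≡1 = ℚ.≤-reflexive m≡1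

  miss-none : ∀ {F v} → All (_≢ v) F → miss F v ≡ 1ℚ
  miss-none []                  = refl
  miss-none {f ∷ F} (f≢v ∷ F≢v) = trans (miss-skip F f≢v) (miss-none F≢v)

  miss-∈ : ∀ {F v} → v ∈ F → miss F v ≡ 0ℚ
  miss-∈ {f ∷ F} {v} v∈ with f ℕ.≟ v | v∈
  ... | yes _   | _           = refl
  ... | no  f≢v | here v≡f    = contradiction (sym v≡f) f≢v
  ... | no  _   | there v∈F   = miss-∈ v∈F

  -- The new facility changes the indicator only at `f`, which occurs at most once in `us`.
  ∑-miss-∷ : ∀ {us} f F → Unique us → ∑ (miss F) us ≤ 1ℚ + ∑ (miss (f ∷ F)) us
  ∑-miss-∷ {[]}     f F []            = 0≤1
  ∑-miss-∷ {u ∷ us} f F (u∉us ∷ us!) with f ℕ.≟ u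
  ... | yes refl = ℚ.+-mono-≤ (miss≤1 F u) (ℚ.≤-reflexive (trans
    (∑-cong us λ v∈us → sym (miss-skip F (All.lookup u∉us v∈us)))
    (sym (ℚ.+-identityˡ _))))
  ... | no  _    = subst (miss F u + ∑ (miss F) us ≤_)
    (solve 2 (λ m s → m :+ (con 1ℚ :+ s) := con 1ℚ :+ (m :+ s)) refl
      (miss F u) (∑ (miss (f ∷ F)) us))
    (ℚ.+-monoʳ-≤ (miss F u) (∑-miss-∷ f F us!))

  -- Each facility serves at most one of the distinct points at distance 0. Both lower bounds on the
  -- optimum rest on this count.
  length≤facilities+misses : ∀ {us} F → Unique us → ι (length us) ≤ ι (length F) + ∑ (miss F) us
  length≤facilities+misses {us} []      us! = ℚ.≤-reflexive (sym (trans
    (ℚ.+-identityˡ _) (trans (∑-const 1ℚ us) (ℚ.*-identityʳ _))))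
  length≤facilities+misses {us} (f ∷ F) us! = ℚ.≤-trans (length≤facilities+misses F us!)
    (ℚ.≤-trans (ℚ.+-monoʳ-≤ (ι (length F)) (∑-miss-∷ f F us!)) (ℚ.≤-reflexive (trans
      (solve 2 (λ a s → a :+ (con 1ℚ :+ s) := con 1ℚ :+ a :+ s) refl
        (ι (length F)) (∑ (miss (f ∷ F)) us))
      (cong (_+ ∑ (miss (f ∷ F)) us) (sym (ι-suc (length F)))))))

-- Distances from a facility set to a leaf.

module StarDistances (r : ℚ.ℚ) (0<r : ℚ.0ℚ ℚ.< r) where
  open import Data.Rational.Base
  open import Data.Rational.Solver using (module +-*-Solver)
  open +-*-Solver
  open RationalArithmetic
  open Star r 0<r
  open Facilities

  radius-leaf : ∀ {v} → v ≢ 0 → radius v ≡ r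
  radius-leaf {zero}  v≢0 = contradiction refl v≢0
  radius-leaf {suc v} v≢0 = refl

  -- The factor doubles the distance when the centre is not open.
  distance-star : ∀ n f F {v} → v ≢ 0 → seq (distance star (f ∷ F) v) n ≡
    miss (f ∷ F) v * (r + r * miss (f ∷ F) 0)
  distance-star n f [] {v} v≢0 = go (f ℕ.≟ v) (f ℕ.≟ 0)
    where
    go : Dec (f ≡ v) → Dec (f ≡ 0) → d★ f v ≡ miss (f ∷ []) v * (r + r * miss (f ∷ []) 0)
    go (yes refl) _ rewrite miss-here [] v = trans (d★-refl v) (sym (ℚ.*-zeroˡ (r + r * miss (f ∷ []) 0)))
    go (no f≢v) (yes refl) rewrite miss-skip [] f≢v | d★-≢ f≢v | radius-leaf v≢0 =
      solve 1 (λ r → con 0ℚ :+ r := con 1ℚ :* (r :+ r :* con 0ℚ)) refl r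
    go (no f≢v) (no f≢0) rewrite miss-skip [] f≢v | miss-skip [] f≢0 | d★-≢ f≢v
      | radius-leaf v≢0 | radius-leaf f≢0 =
      solve 1 (λ r → r :+ r := con 1ℚ :* (r :+ r :* con 1ℚ)) refl r
  distance-star n f (g ∷ G) {v} v≢0 = go (f ℕ.≟ v) (f ℕ.≟ 0)
    where
    m m₀ : ℚ
    m  = miss (g ∷ G) v
    m₀ = miss (g ∷ G) 0
    IH : seq (distance star (g ∷ G) v) n ≡ m * (r + r * m₀)
    IH = distance-star n g G v≢0
    0≤rm₀ : 0ℚ ≤ r * m₀
    0≤rm₀ = 0≤* 0≤r (0≤miss (g ∷ G) 0)
    go : Dec (f ≡ v) → Dec (f ≡ 0) → d★ f v ⊓ seq (distance star (g ∷ G) v) n ≡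
      miss (f ∷ g ∷ G) v * (r + r * miss (f ∷ g ∷ G) 0)
    go (yes refl) _ rewrite miss-here (g ∷ G) v | IH | d★-refl v = trans
      (ℚ.p≤q⇒p⊓q≡p (0≤* (0≤miss (g ∷ G) v) (0≤+ 0≤r 0≤rm₀)))
      (sym (ℚ.*-zeroˡ (r + r * miss (f ∷ g ∷ G) 0)))
    go (no f≢v) (yes refl) rewrite miss-skip (g ∷ G) f≢v | d★-≢ f≢v | radius-leaf v≢0 | IH
      with miss-0∨1 (g ∷ G) v
    ... | inj₁ m≡0 rewrite m≡0 | ℚ.*-zeroˡ (r + r * m₀) | ℚ.+-identityˡ r =
      trans (ℚ.p≥q⇒p⊓q≡q 0≤r) (sym (ℚ.*-zeroˡ (r + r * 0ℚ)))
    ... | inj₂ m≡1 rewrite m≡1 | ℚ.*-identityˡ (r + r * m₀) | ℚ.+-identityˡ r =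
      trans (ℚ.p≤q⇒p⊓q≡p (≤-gap (r * m₀) 0≤rm₀ refl))
        (solve 1 (λ r → r := con 1ℚ :* (r :+ r :* con 0ℚ)) refl r)
    -- Another leaf `f` is at distance `r + r`, the largest value the formula can take, so adding it
    -- leaves the minimum unchanged.
    go (no f≢v) (no f≢0) rewrite miss-skip (g ∷ G) f≢v | miss-skip (g ∷ G) f≢0 | d★-≢ f≢v
      | radius-leaf v≢0 | radius-leaf f≢0 | IH = ℚ.p≥q⇒p⊓q≡q (ℚ.≤-trans
        (≤-gap ((1ℚ - m) * (r + r * m₀)) (0≤* (0≤q-p (miss≤1 (g ∷ G) v)) (0≤+ 0≤r 0≤rm₀))
          (solve 2 (λ m x → x := m :* x :+ (con 1ℚ :- m) :* x) refl m (r + r * m₀)))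
        (≤-gap (r * (1ℚ - m₀)) (0≤* 0≤r (0≤q-p (miss≤1 (g ∷ G) 0)))
          (solve 2 (λ r m₀ → r :+ r := r :+ r :* m₀ :+ r :* (con 1ℚ :- m₀)) refl r m₀)))

-- Number of demands at a leaf.

module Multiplicity where

  one-if-≡ : ℕ → ℕ → ℕ
  one-if-≡ u v with v ℕ.≟ u
  ... | yes _ = 1
  ... | no  _ = 0

  -- Written as a sum so that independence of the arrival order is an instance of `sum-↭`.
  count : ℕ → List ℕ → ℕ
  count u vs = sum (List.map (one-if-≡ u) vs)

  count-here : ∀ u vs → count u (u ∷ vs) ≡ suc (count u vs)
  count-here u vs with u ℕ.≟ u
  ... | yes _   = refl
  ... | no  u≢u = contradiction refl u≢u

  count-skip : ∀ {u v} vs → u ≢ v → count u (v ∷ vs) ≡ count u vs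
  count-skip {u} {v} vs u≢v with v ℕ.≟ u
  ... | yes v≡u = contradiction (sym v≡u) u≢v
  ... | no  _   = refl

  count-↭ : ∀ u {vs ws} → vs ↭ ws → count u vs ≡ count u ws
  count-↭ u vs↭ws = sum-↭ (map⁺ (one-if-≡ u) vs↭ws)

  count-++ : ∀ u vs ws → count u (vs ++ ws) ≡ count u vs ℕ.+ count u ws
  count-++ u vs ws = trans (cong sum (List.map-++ (one-if-≡ u) vs ws))
    (sum-++ (List.map (one-if-≡ u) vs) (List.map (one-if-≡ u) ws))

  count-replicate : ∀ u c → count u (replicate c u) ≡ c
  count-replicate u zero    = refl
  count-replicate u (suc c) = trans (count-here u (replicate c u)) (cong suc (count-replicate u c))

  count-replicate-≢ : ∀ {u v} c → u ≢ v → count u (replicate c v) ≡ 0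
  count-replicate-≢ zero    u≢v = refl
  count-replicate-≢ {u} {v} (suc c) u≢v =
    trans (count-skip (replicate c v) u≢v) (count-replicate-≢ c u≢v)

  copies : ℕ → List ℕ → List ℕ
  copies c = concatMap (replicate c)

  count-copies-none : ∀ {u} c {us} → All (u ≢_) us → count u (copies c us) ≡ 0
  count-copies-none c []                 = refl
  count-copies-none {u} c {v ∷ us} (u≢v ∷ u≢us) = trans (count-++ u (replicate c v) (copies c us))
    (cong₂ ℕ._+_ (count-replicate-≢ c u≢v) (count-copies-none c u≢us))

  count-copies : ∀ {u} c {us} → Unique us → u ∈ us → count u (copies c us) ≡ c
  count-copies {u} c {u ∷ us} (u∉us ∷ _) (here refl) = trans (count-++ u (replicate c u) (copies c us))
    (trans (cong₂ ℕ._+_ (count-replicate u c) (count-copies-none c u∉us)) (ℕ.+-identityʳ c))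
  count-copies {u} c {v ∷ us} (v∉us ∷ us!) (there u∈us) = trans (count-++ u (replicate c v) (copies c us))
    (cong₂ ℕ._+_ (count-replicate-≢ c (All.lookup v∉us u∈us ∘ sym)) (count-copies c us! u∈us))

  copies⊆ : ∀ c us → All (_∈ us) (copies c us)
  copies⊆ c us = All.concat⁺ (All.map⁺ (All.tabulate λ u∈us → All.replicate⁺ c u∈us))

-- Expected cost of a single leaf and its limit.

module LeafCost (p D : ℚ.ℚ) where
  open import Data.Rational.Base
  open import Data.Rational.Solver using (module +-*-Solver)
  open +-*-Solver
  open RationalArithmetic

  -- Expected expenditure caused by c demands at a leaf that is at distance D
  -- from the open facilities, up to and including the opening of that leaf.
  leafCost : ℕ → ℚ
  leafCost zero    = 0ℚ
  leafCost (suc c) = p + (1ℚ - p) * (D + leafCost c)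

  -- B is the limit of leafCost.
  module _ {B : ℚ} (0≤B : 0ℚ ≤ B) (p≤1 : p ≤ 1ℚ) (fixed : p * B ≡ p + (1ℚ - p) * D) where

    deficit : ℕ → ℚ
    deficit c = B - leafCost c

    -- By `fixed`, `B` is a fixed point of the recursion for `leafCost`; subtracting the recursion
    -- from the fixed-point equation leaves the factor `1 - p`.
    deficit-suc : ∀ c → deficit (suc c) ≡ (1ℚ - p) * deficit c
    deficit-suc c = trans
      (solve 4 (λ p d b a → b :- (p :+ (con 1ℚ :- p) :* (d :+ a)) :=
        b :- (p :+ (con 1ℚ :- p) :* d) :- (con 1ℚ :- p) :* a) refl p D B (leafCost c))
      (trans (cong (λ z → B - z - (1ℚ - p) * leafCost c) (sym fixed))
        (solve 3 (λ p b a → b :- p :* b :- (con 1ℚ :- p) :* a := (con 1ℚ :- p) :* (b :- a)) refl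
          p B (leafCost c)))

    0≤deficit : ∀ c → 0ℚ ≤ deficit c
    0≤deficit zero    = 0≤q-p 0≤B
    0≤deficit (suc c) = subst (0ℚ ≤_) (sym (deficit-suc c)) (0≤* (0≤q-p p≤1) (0≤deficit c))

    -- Bernoulli's inequality for deficit c = (1 - p) ^ c * B.
    deficit-bound : ∀ c → deficit c * (1ℚ + p * ι c) ≤ B
    deficit-bound zero    = ℚ.≤-reflexive
      (solve 2 (λ p b → (b :- con 0ℚ) :* (con 1ℚ :+ p :* con 0ℚ) := b) refl p B)
    deficit-bound (suc c) = subst (_≤ B)
      (sym (cong₂ (λ e k → e * (1ℚ + p * k)) (deficit-suc c) (ι-suc c)))
      (ℚ.≤-trans (≤-gap (deficit c * (p * p) * (1ℚ + ι c))
          (0≤* (0≤* (0≤deficit c) (0≤p*p p)) (0≤+ 0≤1 (0≤ι c)))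
          (solve 3 (λ p e k → e :* (con 1ℚ :+ p :* k) :=
            (con 1ℚ :- p) :* e :* (con 1ℚ :+ p :* (con 1ℚ :+ k)) :+ e :* (p :* p) :* (con 1ℚ :+ k)) refl
            p (deficit c) (ι c)))
        (deficit-bound c))

-- Exact expected cost of the algorithm on a star.

module StarExecution (r : ℚ.ℚ) (0<r : ℚ.0ℚ ℚ.< r) (q : ℝ) (n : ℕ)
  (qD≤1 : seq q n ℚ.* (r ℚ.+ r) ℚ.≤ ℚ.1ℚ) where
  open import Data.Rational.Base
  open import Data.Rational.Solver using (module +-*-Solver)
  open +-*-Solver
  open RationalArithmetic
  open Sums
  open Expectation
  open Star r 0<r using (star)
  open Facilities
  open StarDistances r 0<r
  open Multiplicity
  open Execution star q n

  D p : ℚ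
  D = r + r
  p = seq q n * D

  open LeafCost p D

  -- With the centre closed the factor in `distance-star` is `r + r`. Hence the opening probability
  -- at a closed leaf does not depend on which other leaves are open.
  dist-leaf : ∀ f F {v} → All (_≢ 0) (f ∷ F) → v ≢ 0 → dist (f ∷ F) v ≡ miss (f ∷ F) v * D
  dist-leaf f F {v} F≢0 v≢0 = trans (distance-star n f F v≢0)
    (cong (miss (f ∷ F) v *_) (trans (cong (λ m → r + r * m) (miss-none F≢0))
      (cong (r +_) (ℚ.*-identityʳ r))))

  dist-self : ∀ F v → v ≢ 0 → dist (v ∷ F) v ≡ 0ℚ
  dist-self F v v≢0 = trans (distance-star n v F v≢0)
    (trans (cong (_* (r + r * miss (v ∷ F) 0)) (miss-here F v)) (ℚ.*-zeroˡ (r + r * miss (v ∷ F) 0)))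

  module _ {us} (us! : Unique us) (us≢0 : All (_≢ 0) us) where

    -- Closed form for the expected cost still to come: open leaves are settled, and each closed
    -- leaf contributes separately according to its remaining demands.
    pending : List ℕ → List ℕ → ℚ
    pending F vs = ∑ (λ u → miss F u * leafCost (count u vs)) us

    pending-old : ∀ F v vs → miss F v ≡ 0ℚ → pending F (v ∷ vs) ≡ pending F vs
    pending-old F v vs m≡0 = ∑-cong us λ {u} _ → go u (u ℕ.≟ v)
      where
      go : ∀ u → Dec (u ≡ v) →
        miss F u * leafCost (count u (v ∷ vs)) ≡ miss F u * leafCost (count u vs)
      go u (yes refl) rewrite m≡0 = trans (ℚ.*-zeroˡ (leafCost (count u (u ∷ vs))))
        (sym (ℚ.*-zeroˡ (leafCost (count u vs))))
      go u (no u≢v)   = cong (λ k → miss F u * leafCost k) (count-skip vs u≢v)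

    -- At `v` this is the recursion for `leafCost`. The other summands are the same whether or not
    -- `v` is opened, so they split into their parts `p` and `1 - p`.
    pending-new : ∀ F v vs → v ∈ us → miss F v ≡ 1ℚ → pending F (v ∷ vs) ≡
      p * pending (v ∷ F) vs + (1ℚ - p) * pending F vs + (p + (1ℚ - p) * D)
    pending-new F v vs v∈us m≡1 = trans
      (∑-update (p + (1ℚ - p) * D) us! v∈us other self)
      (cong (_+ (p + (1ℚ - p) * D)) (trans
        (∑-distrib-+ (λ u → p * (miss (v ∷ F) u * leafCost (count u vs)))
          (λ u → (1ℚ - p) * (miss F u * leafCost (count u vs))) us)
        (cong₂ _+_ (∑-distribˡ p (λ u → miss (v ∷ F) u * leafCost (count u vs)) us)
          (∑-distribˡ (1ℚ - p) (λ u → miss F u * leafCost (count u vs)) us))))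
      where
      other : ∀ {u} → u ∈ us → u ≢ v → miss F u * leafCost (count u (v ∷ vs)) ≡
        p * (miss (v ∷ F) u * leafCost (count u vs)) + (1ℚ - p) * (miss F u * leafCost (count u vs))
      other {u} _ u≢v rewrite count-skip vs u≢v | miss-skip F (u≢v ∘ sym) =
        solve 2 (λ p x → x := p :* x :+ (con 1ℚ :- p) :* x) refl p (miss F u * leafCost (count u vs))
      self : miss F v * leafCost (count v (v ∷ vs)) ≡
        p * (miss (v ∷ F) v * leafCost (count v vs)) + (1ℚ - p) * (miss F v * leafCost (count v vs)) +
          (p + (1ℚ - p) * D)
      self rewrite count-here v vs | miss-here F v | m≡1 =
        solve 3 (λ p d x → con 1ℚ :* (p :+ (con 1ℚ :- p) :* (d :+ x)) :=
          p :* (con 0ℚ :* x) :+ (con 1ℚ :- p) :* (con 1ℚ :* x) :+ (p :+ (con 1ℚ :- p) :* d))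
          refl p D (leafCost (count v vs))

    -- Induction on the remaining demands, for all sets of open leaves at once because the coin may
    -- enlarge `F`. A demand at an open leaf is free and opens nothing. At a closed leaf, `qD≤1`
    -- makes the truncation at 1 inactive, and `pending-new` matches the two outcomes of the coin.
    runCost-leaves : ∀ f F vs → All (_≢ 0) (f ∷ F) → All (_∈ us) vs →
      runCost (f ∷ F) vs ≡ ι (length (f ∷ F)) + pending (f ∷ F) vs
    runCost-leaves f F [] F≢0 [] = trans (runCost-[] (f ∷ F))
      (trans (sym (ℚ.+-identityʳ (ι (length (f ∷ F))))) (cong (ι (length (f ∷ F)) +_) (sym
        (trans (∑-cong us λ {u} _ → ℚ.*-zeroʳ (miss (f ∷ F) u))
          (trans (∑-const 0ℚ us) (ℚ.*-zeroʳ (ι (length us))))))))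
    runCost-leaves f F (v ∷ vs) F≢0 (v∈us ∷ vs⊆us) = trans (runCost-next f F v vs)
      (go (miss-0∨1 (f ∷ F) v) (dist-leaf f F F≢0 v≢0) (dist-self (f ∷ F) v v≢0)
        (runCost-leaves v (f ∷ F) vs (v≢0 ∷ F≢0) vs⊆us) (runCost-leaves f F vs F≢0 vs⊆us))
      where
      v≢0 : v ≢ 0
      v≢0 = All.lookup us≢0 v∈us
      m l S₀ S₁ : ℚ
      m = miss (f ∷ F) v
      l = ι (length (f ∷ F))
      S₀ = pending (f ∷ F) vs
      S₁ = pending (v ∷ f ∷ F) vs
      go : ∀ {δ δ′ x y} → m ≡ 0ℚ ⊎ m ≡ 1ℚ → δ ≡ m * D → δ′ ≡ 0ℚ →
        x ≡ ι (length (v ∷ f ∷ F)) + S₁ → y ≡ l + S₀ →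
        ((seq q n * δ) ⊓ 1ℚ) * (δ′ + x) + (1ℚ - (seq q n * δ) ⊓ 1ℚ) * (δ + y) ≡
        l + pending (f ∷ F) (v ∷ vs)
      go {x = x} {y} (inj₁ m≡0) refl refl refl refl = trans
        (cong₂ (λ a δ → a * (0ℚ + x) + (1ℚ - a) * (δ + y)) a≡0 δ≡0) (trans
        (solve 2 (λ x y → con 0ℚ :* (con 0ℚ :+ x) :+ (con 1ℚ :- con 0ℚ) :* (con 0ℚ :+ y) := y) refl x y)
        (cong (l +_) (sym (pending-old (f ∷ F) v vs m≡0))))
        where
        δ≡0 : m * D ≡ 0ℚ
        δ≡0 = trans (cong (_* D) m≡0) (ℚ.*-zeroˡ D)
        a≡0 : (seq q n * (m * D)) ⊓ 1ℚ ≡ 0ℚ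
        a≡0 = cong (_⊓ 1ℚ) (trans (cong (seq q n *_) δ≡0) (ℚ.*-zeroʳ (seq q n)))
      go {x = x} {y} (inj₂ m≡1) refl refl refl refl = trans
        (cong₂ (λ a δ → a * (0ℚ + x) + (1ℚ - a) * (δ + y)) a≡p δ≡D) (trans
        (cong (λ k → p * (0ℚ + (k + S₁)) + (1ℚ - p) * (D + y)) (ι-suc (length (f ∷ F)))) (trans
        (solve 5 (λ p d l x y →
          p :* (con 0ℚ :+ (con 1ℚ :+ l :+ x)) :+ (con 1ℚ :- p) :* (d :+ (l :+ y)) :=
          l :+ (p :* x :+ (con 1ℚ :- p) :* y :+ (p :+ (con 1ℚ :- p) :* d))) refl
          p D l S₁ S₀)
        (cong (l +_) (sym (pending-new (f ∷ F) v vs v∈us m≡1)))))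
        where
        δ≡D : m * D ≡ D
        δ≡D = trans (cong (_* D) m≡1) (ℚ.*-identityˡ D)
        a≡p : (seq q n * (m * D)) ⊓ 1ℚ ≡ p
        a≡p = trans (cong (λ δ → (seq q n * δ) ⊓ 1ℚ) δ≡D) (ℚ.p≤q⇒p⊓q≡p qD≤1)

    -- The first demand opens its own leaf for the cost 1 and so settles that leaf; every other leaf
    -- still has all of its `c` demands to come. The value does not mention the order, as
    -- `𝔼-randomOrder-const` requires.
    runCost-arrangement : ∀ c v vs → All (_∈ us) (v ∷ vs) →
      (∀ {u} → u ∈ us → count u (v ∷ vs) ≡ c) →
      runCost [] (v ∷ vs) ≡ 1ℚ + (ι (length us) * leafCost c - leafCost c)
    runCost-arrangement c v vs (v∈us ∷ vs⊆us) count≡c = begin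
      runCost [] (v ∷ vs)
        ≡⟨ runCost-first v vs ⟩
      dist (v ∷ []) v + runCost (v ∷ []) vs
        ≡⟨ cong₂ _+_ (dist-self [] v v≢0) (runCost-leaves v [] vs (v≢0 ∷ []) vs⊆us) ⟩
      0ℚ + (1ℚ + pending (v ∷ []) vs)
        ≡⟨ solve 2 (λ x a → con 0ℚ :+ (con 1ℚ :+ x) := con 1ℚ :+ (x :+ a :- a)) refl
             (pending (v ∷ []) vs) (leafCost c) ⟩
      1ℚ + (pending (v ∷ []) vs + leafCost c - leafCost c)
        ≡⟨ cong (λ s → 1ℚ + (s - leafCost c)) (∑-update (leafCost c) us! v∈us other self) ⟨
      1ℚ + (∑ (λ _ → leafCost c) us - leafCost c)
        ≡⟨ cong (λ s → 1ℚ + (s - leafCost c)) (∑-const (leafCost c) us) ⟩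
      1ℚ + (ι (length us) * leafCost c - leafCost c) ∎
      where
      open ≡-Reasoning
      v≢0 : v ≢ 0
      v≢0 = All.lookup us≢0 v∈us
      other : ∀ {u} → u ∈ us → u ≢ v → leafCost c ≡ miss (v ∷ []) u * leafCost (count u vs)
      other {u} u∈us u≢v = sym (trans
        (cong₂ _*_ (miss-skip [] (u≢v ∘ sym)) (cong leafCost
          (trans (sym (count-skip vs u≢v)) (count≡c u∈us))))
        (ℚ.*-identityˡ (leafCost c)))
      self : leafCost c ≡ miss (v ∷ []) v * leafCost (count v vs) + leafCost c
      self = trans (sym (ℚ.+-identityˡ (leafCost c))) (cong (_+ leafCost c) (sym
        (trans (cong (_* leafCost (count v vs)) (miss-here [] v)) (ℚ.*-zeroˡ (leafCost (count v vs))))))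

    E-ALG : ∀ c x xs → (∀ {u} → u ∈ us → count u (x ∷ xs) ≡ c) → All (_∈ us) (x ∷ xs) →
      seq (E (randomOrder (x ∷ xs) >>= run star q [])) n ≡ 1ℚ + (ι (length us) * leafCost c - leafCost c)
    E-ALG c x xs count≡c xs⊆us = trans (E-randomOrder-run (x ∷ xs))
      (𝔼-randomOrder-const n (x ∷ xs) (runCost []) arrangement)
      where
      arrangement : ∀ {ys} → ys ↭ x ∷ xs → runCost [] ys ≡ 1ℚ + (ι (length us) * leafCost c - leafCost c)
      arrangement {[]}     ys↭ = contradiction (↭-sym ys↭) ¬x∷xs↭[]
      arrangement {y ∷ ys} ys↭ = runCost-arrangement c y ys (All-resp-↭ (↭-sym ys↭) xs⊆us)
        (λ {u} u∈us → trans (count-↭ u ys↭) (count≡c u∈us))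

-- Star instances and their optima.

module StarInstance (r : ℚ.ℚ) (0<r : ℚ.0ℚ ℚ.< r) (c l : ℕ) where
  open import Data.Rational.Base
  open import Data.Rational.Solver using (module +-*-Solver)
  open +-*-Solver
  open RationalArithmetic
  open Sums
  open RealOrder
  open Star r 0<r
  open Facilities
  open StarDistances r 0<r
  open Multiplicity
  open LeafCost using (leafCost)

  leaves : List ℕ
  leaves = List.map suc (List.downFrom (suc l))

  length-leaves : length leaves ≡ suc l
  length-leaves = trans (List.length-map suc (List.downFrom (suc l))) (List.length-downFrom (suc l))

  leaves! : Unique leaves
  leaves! = Unique.map⁺ ℕ.suc-injective (Unique.downFrom⁺ (suc l))

  leaves≢0 : All (_≢ 0) leaves
  leaves≢0 = All.map⁺ (All.universal (λ _ ()) (List.downFrom (suc l)))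

  -- This is `copies (suc c) leaves` with its head exposed. Both parameters are shifted by one,
  -- which makes the instance nonempty.
  demands★ : List⁺ ℕ
  demands★ = suc l ∷ (replicate c (suc l) ++ copies (suc c) (List.map suc (List.downFrom l)))

  starInstance : Instance
  starInstance = record { space = star ; demands = demands★ }

  sum-seq : ∀ n F vs → seq (Defs.sum (List.map (distance star F) vs)) n ≡
    ∑ (λ v → seq (distance star F v) n) vs
  sum-seq n F []       = refl
  sum-seq n F (v ∷ vs) = cong (seq (distance star F v) n +_) (sum-seq n F vs)

  ∑-copies : ∀ m g us → ∑ g (copies m us) ≡ ι m * ∑ g us
  ∑-copies m g []       = sym (ℚ.*-zeroʳ (ι m))
  ∑-copies m g (u ∷ us) = trans (∑-++ g (replicate m u) (copies m us)) (trans
    (cong₂ _+_ (∑-replicate m) (∑-copies m g us)) (sym (ℚ.*-distribˡ-+ (ι m) (g u) (∑ g us))))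
    where
    ∑-replicate : ∀ m → ∑ g (replicate m u) ≡ ι m * g u
    ∑-replicate zero    = sym (ℚ.*-zeroˡ (g u))
    ∑-replicate (suc m) = trans (cong (g u +_) (∑-replicate m)) (trans
      (solve 2 (λ m x → x :+ m :* x := (con 1ℚ :+ m) :* x) refl (ι m) (g u))
      (cong (_* g u) (sym (ι-suc m))))

  misses : List ℕ → ℚ
  misses F = ∑ (miss F) leaves

  0≤misses : ∀ F → 0ℚ ≤ misses F
  0≤misses F = subst (_≤ misses F) (trans (∑-const 0ℚ leaves) (ℚ.*-zeroʳ (ι (length leaves))))
    (∑-mono leaves λ {u} _ → 0≤miss F u)

  misses≤ : ∀ F → misses F ≤ ι (suc l)
  misses≤ F = subst (misses F ≤_)
    (trans (∑-const 1ℚ leaves) (trans (ℚ.*-identityʳ (ι (length leaves))) (cong ι length-leaves)))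
    (∑-mono leaves λ {u} _ → miss≤1 F u)

  -- Only three numbers of a facility set matter: its size, how many leaves it misses, and whether
  -- it misses the centre. Finding the optimum becomes a problem in these three.
  cost-star : ∀ n f F → seq (cost star demands★ (f ∷ F)) n ≡
    ι (length (f ∷ F)) + ι (suc c) * (misses (f ∷ F) * (r + r * miss (f ∷ F) 0))
  cost-star n f F = cong (ι (length (f ∷ F)) +_) (begin
    seq (Defs.sum (List.map (distance star (f ∷ F)) (toList demands★))) n
      ≡⟨ sum-seq n (f ∷ F) (copies (suc c) leaves) ⟩
    ∑ (λ v → seq (distance star (f ∷ F) v) n) (copies (suc c) leaves)
      ≡⟨ ∑-copies (suc c) (λ v → seq (distance star (f ∷ F) v) n) leaves ⟩
    ι (suc c) * ∑ (λ v → seq (distance star (f ∷ F) v) n) leaves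
      ≡⟨ cong (ι (suc c) *_) (∑-cong leaves λ v∈ → trans
           (distance-star n f F (All.lookup leaves≢0 v∈)) (ℚ.*-comm _ ρ)) ⟩
    ι (suc c) * ∑ (λ v → ρ * miss (f ∷ F) v) leaves
      ≡⟨ cong (ι (suc c) *_) (trans (∑-distribˡ ρ (miss (f ∷ F)) leaves) (ℚ.*-comm ρ (misses (f ∷ F)))) ⟩
    ι (suc c) * (misses (f ∷ F) * ρ) ∎)
    where
    open ≡-Reasoning
    ρ : ℚ
    ρ = r + r * miss (f ∷ F) 0

  isOPT-intro : ∀ o f F → Unique (f ∷ F) →
    ι (length (f ∷ F)) + ι (suc c) * (misses (f ∷ F) * (r + r * miss (f ∷ F) 0)) ≡ o →
    (∀ g G → o ≤ ι (length (g ∷ G)) + ι (suc c) * (misses (g ∷ G) * (r + r * miss (g ∷ G) 0))) →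
    IsOPT starInstance (fromℚ o)
  isOPT-intro o f F F! cost≡o o≤cost =
    ((f ∷ F) , F! , termwise-≈ {cost star demands★ (f ∷ F)} {fromℚ o} (λ n → trans (cost-star n f F) cost≡o)) ,
    λ { (g ∷ G) _ → termwise-≤ {fromℚ o} {cost star demands★ (g ∷ G)}
      (λ n → subst (o ≤_) (sym (cost-star n g G)) (o≤cost g G)) }

  1≤length : ∀ (g : ℕ) G → 1ℚ ≤ ι (length (g ∷ G))
  1≤length g G = ι-mono-≤ {1} {length (g ∷ G)} (ℕ.s≤s ℕ.z≤n)

  -- By the hypothesis, the demands of a missed leaf cost at least 1 even when the centre is open.
  -- So any cost is at least the number of facilities plus the number of missed leaves.
  OPT-leaves : 1ℚ ≤ ι (suc c) * r → IsOPT starInstance (fromℚ (ι (suc l)))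
  OPT-leaves 1≤cr = isOPT-intro (ι (suc l)) (suc l) (List.map suc (List.downFrom l)) leaves!
    (trans (cong₂ (λ k m → ι k + ι (suc c) * (m * (r + r * miss leaves 0))) length-leaves misses≡0)
      (solve 3 (λ x c y → x :+ c :* (con 0ℚ :* y) := x) refl (ι (suc l)) (ι (suc c)) (r + r * miss leaves 0)))
    lower
    where
    misses≡0 : misses leaves ≡ 0ℚ
    misses≡0 = trans (∑-cong leaves miss-∈) (trans (∑-const 0ℚ leaves) (ℚ.*-zeroʳ (ι (length leaves))))
    lower : ∀ g G → ι (suc l) ≤ ι (length (g ∷ G)) + ι (suc c) * (misses (g ∷ G) * (r + r * miss (g ∷ G) 0))
    lower g G = ℚ.≤-trans
      (subst (λ k → ι k ≤ ι (length (g ∷ G)) + M) length-leaves (length≤facilities+misses (g ∷ G) leaves!))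
      (≤-gap ((ι (suc c) * r - 1ℚ) * M + ι (suc c) * r * M * m₀)
        (0≤+ (0≤* (0≤q-p 1≤cr) (0≤misses (g ∷ G)))
          (0≤* (0≤* (0≤* (0≤ι (suc c)) 0≤r) (0≤misses (g ∷ G))) (0≤miss (g ∷ G) 0)))
        (solve 5 (λ x c m r m₀ → x :+ c :* (m :* (r :+ r :* m₀)) :=
          x :+ m :+ ((c :* r :- con 1ℚ) :* m :+ c :* r :* m :* m₀)) refl
          (ι (length (g ∷ G))) (ι (suc c)) M r m₀))
      where
      M m₀ : ℚ
      M  = misses (g ∷ G)
      m₀ = miss (g ∷ G) 0

  OPT-centre : c ≡ 0 → 1 ℕ.≤ l → r + r ≤ 1ℚ → IsOPT starInstance (fromℚ (1ℚ + ι (suc l) * r))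
  OPT-centre refl 1≤l D≤1 = isOPT-intro (1ℚ + ι (suc l) * r) 0 [] ([] ∷ [])
    (trans (cong (λ m → 1ℚ + 1ℚ * (m * (r + r * 0ℚ))) misses≡)
      (solve 2 (λ x r → con 1ℚ :+ con 1ℚ :* (x :* (r :+ r :* con 0ℚ)) := con 1ℚ :+ x :* r) refl
        (ι (suc l)) r))
    lower
    where
    misses≡ : misses (0 ∷ []) ≡ ι (suc l)
    misses≡ = trans (∑-cong leaves λ v∈ → miss-none ((All.lookup leaves≢0 v∈ ∘ sym) ∷ []))
      (trans (∑-const 1ℚ leaves) (trans (ℚ.*-identityʳ (ι (length leaves))) (cong ι length-leaves)))
    r≤1 : r ≤ 1ℚ
    r≤1 = ℚ.≤-trans (≤-gap r 0≤r refl) D≤1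
    lower : ∀ g G → 1ℚ + ι (suc l) * r ≤
      ι (length (g ∷ G)) + 1ℚ * (misses (g ∷ G) * (r + r * miss (g ∷ G) 0))
    lower g G = go (miss-0∨1 (g ∷ G) 0)
      where
      φ L M m₀ : ℚ
      φ  = ι (length (g ∷ G))
      L  = ι (suc l)
      M  = misses (g ∷ G)
      m₀ = miss (g ∷ G) 0
      L≤φ+M : L ≤ φ + M
      L≤φ+M = subst (λ k → ι k ≤ φ + M) length-leaves (length≤facilities+misses (g ∷ G) leaves!)
      1+L≤φ+m₀+M : ι (suc (suc l)) ≤ φ + (m₀ + M)
      1+L≤φ+m₀+M = subst (λ k → ι (suc k) ≤ φ + (m₀ + M)) length-leaves
        (length≤facilities+misses (g ∷ G) (All.map (λ u≢0 → u≢0 ∘ sym) leaves≢0 ∷ leaves!))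
      go : m₀ ≡ 0ℚ ⊎ m₀ ≡ 1ℚ → 1ℚ + L * r ≤ φ + 1ℚ * (M * (r + r * m₀))
      -- With the centre open, counting it as a further point gives `1 + L ≤ φ + M`: the `L - M`
      -- leaves served at distance 0 cost 1 each but save only `r` each.
      go (inj₁ m₀≡0) = subst (λ m → 1ℚ + L * r ≤ φ + 1ℚ * (M * (r + r * m))) (sym m₀≡0)
        (≤-gap ((φ + (0ℚ + M) - (1ℚ + L)) + (1ℚ - r) * (L - M))
          (0≤+ (0≤q-p (subst (λ m → 1ℚ + L ≤ φ + (m + M)) m₀≡0
                  (subst (_≤ φ + (m₀ + M)) (ι-suc (suc l)) 1+L≤φ+m₀+M)))
            (0≤* (0≤q-p r≤1) (0≤q-p (misses≤ (g ∷ G)))))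
          (solve 4 (λ φ M L r → φ :+ con 1ℚ :* (M :* (r :+ r :* con 0ℚ)) :=
            con 1ℚ :+ L :* r :+ ((φ :+ (con 0ℚ :+ M) :- (con 1ℚ :+ L)) :+ (con 1ℚ :- r) :* (L :- M))) refl
            φ M L r))
      -- With the centre closed, the share `1 - 2r` of `φ` is bounded by `1 ≤ φ`, and the share `2r`
      -- together with the assignment cost by `L ≤ φ + M`. This leaves `r * (L - 2)`, nonnegative
      -- since there are at least two leaves.
      go (inj₂ m₀≡1) = subst (λ m → 1ℚ + L * r ≤ φ + 1ℚ * (M * (r + r * m))) (sym m₀≡1)
        (≤-gap ((1ℚ - (r + r)) * (φ - 1ℚ) + (r + r) * (φ + M - L) + r * (L - ι 2))
          (0≤+ (0≤+ (0≤* (0≤q-p D≤1) (0≤q-p (1≤length g G)))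
              (0≤* (0≤+ 0≤r 0≤r) (0≤q-p L≤φ+M)))
            (0≤* 0≤r (0≤q-p (ι-mono-≤ (ℕ.s≤s 1≤l)))))
          (solve 4 (λ φ M L r → φ :+ con 1ℚ :* (M :* (r :+ r :* con 1ℚ)) :=
            con 1ℚ :+ L :* r :+ ((con 1ℚ :- (r :+ r)) :* (φ :- con 1ℚ) :+ (r :+ r) :* (φ :+ M :- L) :+
              r :* (L :- con (ι 2)))) refl
            φ M L r))

  E-star : ∀ (q : ℝ) n → seq q n * (r + r) ≤ 1ℚ →
    let A = leafCost (seq q n * (r + r)) (r + r) (suc c) in
    seq (E (qDistProb q starInstance)) n ≡ 1ℚ + (ι (suc l) * A - A)
  E-star q n qD≤1 = trans
    (E-ALG leaves! leaves≢0 (suc c) _ _ (count-copies (suc c) leaves!) (copies⊆ (suc c) leaves))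
    (cong (λ k → 1ℚ + (ι k * A - A)) length-leaves)
    where
    open StarExecution r 0<r q n qD≤1
    A : ℚ
    A = leafCost (seq q n * (r + r)) (r + r) (suc c)

-- Ratio estimates in the rationals, with `x` for q, `y` for 1/q, `Y` for a bound on `y` and `K` for
-- 1/D.

module Estimates {x y Y D K : ℚ.ℚ} (0≤x : ℚ.0ℚ ℚ.≤ x) (x≤1 : x ℚ.≤ ℚ.1ℚ) (xy≡1 : x ℚ.* y ≡ ℚ.1ℚ)
  (0≤y : ℚ.0ℚ ℚ.≤ y) (1≤Yx : ℚ.1ℚ ℚ.≤ Y ℚ.* x) (0≤Y : ℚ.0ℚ ℚ.≤ Y)
  (0≤D : ℚ.0ℚ ℚ.≤ D) (0≤K : ℚ.0ℚ ℚ.≤ K) (DK≡1 : D ℚ.* K ≡ ℚ.1ℚ) where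
  open import Data.Rational.Base
  open import Data.Rational.Solver using (module +-*-Solver)
  open +-*-Solver
  open RationalArithmetic

  0≤1+x : 0ℚ ≤ 1ℚ + x
  0≤1+x = 0≤+ 0≤1 0≤x

  y≤Y : y ≤ Y
  y≤Y = ≤-gap-mod (y * (Y * x - 1ℚ)) 0ℚ (- Y) (0≤* 0≤y (0≤q-p 1≤Yx)) DK≡1 xy≡1
    (solve 5 (λ x y Y D K → Y := y :+ y :* (Y :* x :- con 1ℚ) :+ con 0ℚ :* (D :* K :- con 1ℚ) :+
      (:- Y) :* (x :* y :- con 1ℚ)) refl x y Y D K)

  -- Multiply the hypothesis by `2 * y` and use `x * y = 1`; replacing the remaining `y` by `Y`
  -- makes the error independent of the index.
  y≤2+ : ½ ≤ x + D → y ≤ ι 2 + ι 2 * Y * D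
  y≤2+ ½≤x+D = ≤-gap-mod (ι 2 * y * (x + D - ½) + ι 2 * D * (Y - y)) 0ℚ (- ι 2)
    (0≤+ (0≤* (0≤* (0≤ι 2) 0≤y) (0≤q-p ½≤x+D)) (0≤* (0≤* (0≤ι 2) 0≤D) (0≤q-p y≤Y))) DK≡1 xy≡1
    (solve 5 (λ x y Y D K → con (ι 2) :+ con (ι 2) :* Y :* D :=
      y :+ (con (ι 2) :* y :* (x :+ D :- con ½) :+ con (ι 2) :* D :* (Y :- y)) :+
      con 0ℚ :* (D :* K :- con 1ℚ) :+ con (- ι 2) :* (x :* y :- con 1ℚ)) refl x y Y D K)

  2≤y+ : x ≤ ½ + D → ι 2 ≤ y + ι 2 * Y * D
  2≤y+ x≤½+D = ≤-gap-mod (ι 2 * y * (½ + D - x) + ι 2 * D * (Y - y)) 0ℚ (ι 2)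
    (0≤+ (0≤* (0≤* (0≤ι 2) 0≤y) (0≤q-p x≤½+D)) (0≤* (0≤* (0≤ι 2) 0≤D) (0≤q-p y≤Y))) DK≡1 xy≡1
    (solve 5 (λ x y Y D K → y :+ con (ι 2) :* Y :* D :=
      con (ι 2) :+ (con (ι 2) :* y :* (con ½ :+ D :- x) :+ con (ι 2) :* D :* (Y :- y)) :+
      con 0ℚ :* (D :* K :- con 1ℚ) :+ con (ι 2) :* (x :* y :- con 1ℚ)) refl x y Y D K)

  0≤2YD : 0ℚ ≤ ι 2 * Y * D
  0≤2YD = 0≤* (0≤* (0≤ι 2) 0≤Y) 0≤D

  2⊔y≤2+ : ½ ≤ x + D → ι 2 ⊔ y ≤ ι 2 + ι 2 * Y * D
  2⊔y≤2+ ½≤x+D = ℚ.⊔-lub 2≤ (y≤2+ ½≤x+D)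
    where
    2≤ : ι 2 ≤ ι 2 + ι 2 * Y * D
    2≤ = ≤-gap (ι 2 * Y * D) 0≤2YD refl

  2⊔y≤y+ : x ≤ ½ + D → ι 2 ⊔ y ≤ y + ι 2 * Y * D
  2⊔y≤y+ x≤½+D = ℚ.⊔-lub (2≤y+ x≤½+D) y≤
    where
    y≤ : y ≤ y + ι 2 * Y * D
    y≤ = ≤-gap (ι 2 * Y * D) 0≤2YD refl

  -- Here there are `1 + K * K` leaves with one demand each. Both `2 * (1 + x)` times the optimum
  -- and the cost of the algorithm have the leading term `(1 + x) * K`, so they differ by a bounded
  -- amount. The optimum exceeds `K / 2`, so the loss `(12 + 6 * Y) * D` is worth at least
  -- `6 + 3 * Y`, which covers the difference.
  centre-ratio : ∀ {T} → T ≤ ι 2 + ι 2 * Y * D →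
    ((1ℚ + x) * T - (ι 12 + ι 6 * Y) * D) * (1ℚ + (1ℚ + K * K) * (½ * D)) ≤
    1ℚ + ((1ℚ + K * K) * (x * D + (1ℚ - x * D) * (D + 0ℚ)) - (x * D + (1ℚ - x * D) * (D + 0ℚ)))
  centre-ratio {T} T≤ = ≤-gap-mod
    ((1ℚ + x) * (ι 2 + ι 2 * Y * D - T) * (1ℚ + (1ℚ + K * K) * (½ * D)) +
      (ι 3 * (1ℚ - x) + ι 2 + ι 10 * D + D * (1ℚ - x) + ι 6 * (D * D) +
       ι 2 * Y * (½ + D + ½ * (D * D)) + ι 2 * Y * (1ℚ - x) * (½ + D + ½ * (D * D))))
    -- `K` occurs only squared, so `D * K = 1` is used as D²K² - 1 = (DK + 1)(DK - 1); the second
    -- factor collects the coefficients of D²K².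
    ((D * K + 1ℚ) * (ι 6 + ι 3 * Y - Y * (1ℚ + x) - x)) 0ℚ
    (0≤+ (0≤* (0≤* 0≤1+x (0≤q-p T≤)) (0≤+ 0≤1 (0≤* (0≤+ 0≤1 (0≤p*p K)) (0≤* 0≤½ 0≤D))))
      (0≤+ (0≤+ (0≤+ (0≤+ (0≤+ (0≤+ (0≤* (0≤ι 3) 0≤1-x) (0≤ι 2)) (0≤* (0≤ι 10) 0≤D))
        (0≤* 0≤D 0≤1-x)) (0≤* (0≤ι 6) (0≤p*p D)))
        (0≤* (0≤* (0≤ι 2) 0≤Y) 0≤w)) (0≤* (0≤* (0≤* (0≤ι 2) 0≤Y) 0≤1-x) 0≤w)))
    DK≡1 xy≡1
    (solve 6 (λ x y Y D K T →
      let 1′ = con 1ℚ ; ½′ = con ½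
          o = 1′ :+ (1′ :+ K :* K) :* (½′ :* D)
          a = x :* D :+ (1′ :- x :* D) :* (D :+ con 0ℚ)
          w = ½′ :+ D :+ ½′ :* (D :* D)
      in
      1′ :+ ((1′ :+ K :* K) :* a :- a) :=
      ((1′ :+ x) :* T :- (con (ι 12) :+ con (ι 6) :* Y) :* D) :* o :+
      ((1′ :+ x) :* (con (ι 2) :+ con (ι 2) :* Y :* D :- T) :* o :+
        (con (ι 3) :* (1′ :- x) :+ con (ι 2) :+ con (ι 10) :* D :+ D :* (1′ :- x) :+ con (ι 6) :* (D :* D) :+
         con (ι 2) :* Y :* w :+ con (ι 2) :* Y :* (1′ :- x) :* w)) :+
      (D :* K :+ 1′) :* (con (ι 6) :+ con (ι 3) :* Y :- Y :* (1′ :+ x) :- x) :* (D :* K :- 1′) :+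
      con 0ℚ :* (x :* y :- 1′))
      refl x y Y D K T)
    where
    0≤½ : 0ℚ ≤ ½
    0≤½ = ℚ.nonNegative⁻¹ ½
    0≤1-x : 0ℚ ≤ 1ℚ - x
    0≤1-x = 0≤q-p x≤1
    0≤w : 0ℚ ≤ ½ + D + ½ * (D * D)
    0≤w = 0≤+ (0≤+ 0≤½ 0≤D) (0≤* 0≤½ (0≤p*p D))

  -- By `x * y = 1`, `(1 + x) * y * K` equals `(1 + y) * K`. The cost agrees with it up to a bounded
  -- error, because `K` times the deficit of `A` is bounded. The loss `(12 + 6 * Y) * D * K` is the
  -- constant `12 + 6 * Y` and absorbs that error.
  leaves-ratio : ∀ {T A} → T ≤ y + ι 2 * Y * D →
    0ℚ ≤ 1ℚ + y - D - A → (1ℚ + y - D - A) * K ≤ 1ℚ + y - D →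
    ((1ℚ + x) * T - (ι 12 + ι 6 * Y) * D) * K ≤ 1ℚ + (K * A - A)
  leaves-ratio {T} {A} T≤ 0≤e eK≤B = ≤-gap-mod
    ((1ℚ + x) * K * (y + ι 2 * Y * D - T) + (1ℚ + y - D - (1ℚ + y - D - A) * K) + ι 2 * D +
      (1ℚ + y - D - A) + ι 2 * (Y - y) + ι 2 * Y * (1ℚ - x) + ι 10)
    (ι 11 + ι 6 * Y - ι 2 * Y * (1ℚ + x)) (- K)
    (0≤+ (0≤+ (0≤+ (0≤+ (0≤+ (0≤+ (0≤* (0≤* 0≤1+x 0≤K) (0≤q-p T≤)) (0≤q-p eK≤B))
      (0≤* (0≤ι 2) 0≤D)) 0≤e) (0≤* (0≤ι 2) (0≤q-p y≤Y))) (0≤* (0≤* (0≤ι 2) 0≤Y) (0≤q-p x≤1))) (0≤ι 10))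
    DK≡1 xy≡1
    (solve 7 (λ x y Y D K T A →
      let 1′ = con 1ℚ
          b = 1′ :+ y :- D
      in
      1′ :+ (K :* A :- A) :=
      ((1′ :+ x) :* T :- (con (ι 12) :+ con (ι 6) :* Y) :* D) :* K :+
      ((1′ :+ x) :* K :* (y :+ con (ι 2) :* Y :* D :- T) :+ (b :- (b :- A) :* K) :+ con (ι 2) :* D :+
        (b :- A) :+ con (ι 2) :* (Y :- y) :+ con (ι 2) :* Y :* (1′ :- x) :+ con (ι 10)) :+
      (con (ι 11) :+ con (ι 6) :* Y :- con (ι 2) :* Y :* (1′ :+ x)) :* (D :* K :- 1′) :+
      (:- K) :* (x :* y :- 1′))
      refl x y Y D K T A)

-- Division of reals at the level of terms, and vanishing errors.

module Reciprocal where
  open import Data.Rational.Base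
  open import Data.Rational.Solver using (module +-*-Solver)
  open +-*-Solver
  open RationalArithmetic
  open RealOrder

  p≤∣p∣ : ∀ p → p ≤ ∣ p ∣
  p≤∣p∣ p with ℚ.≤-total 0ℚ p
  ... | inj₁ 0≤p = ℚ.≤-reflexive (sym (ℚ.0≤p⇒∣p∣≡p 0≤p))
  ... | inj₂ p≤0 = ℚ.≤-trans p≤0 (ℚ.0≤∣p∣ p)

  p≤q+∣p-q∣ : ∀ p q → p ≤ q + ∣ p - q ∣
  p≤q+∣p-q∣ p q = subst (_≤ q + ∣ p - q ∣) (solve 2 (λ p q → q :+ (p :- q) := p) refl p q)
    (ℚ.+-monoʳ-≤ q (p≤∣p∣ (p - q)))

  -- Once a term reaches the gap of `0<z`, the clamp inside `inv` is inactive and the term of `inv`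
  -- is the true reciprocal.
  inv-seq : ∀ z (0<z : 0ℝ Defs.< z) n → proj₁ 0<z ≤ seq z n →
    seq z n * seq (inv z 0<z) n ≡ 1ℚ × 0ℚ ≤ seq (inv z 0<z) n
  inv-seq z (e , 0<e , _) n e≤zₙ =
    subst (λ t → t * (1/ s) ≡ 1ℚ) (ℚ.p≥q⇒p⊔q≡p e≤zₙ) (ℚ.*-inverseʳ s) ,
    ℚ.<⇒≤ (ℚ.positive⁻¹ (1/ s) {{ℚ.1/pos⇒pos s}})
    where
    s : ℚ
    s = seq z n ⊔ e
    instance
      s-pos : Positive s
      s-pos = positive (ℚ.<-≤-trans 0<e (ℚ.p≤q⊔p (seq z n) e))
      s-nonZero : NonZero s
      s-nonZero = ℚ.pos⇒nonZero s

  ≤-÷ : ∀ {X o w a} → o * w ≡ 1ℚ → 0ℚ ≤ w → X * o ≤ a → X ≤ a * w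
  ≤-÷ {X} {o} {w} {a} ow≡1 0≤w Xo≤a = ≤-gap-mod ((a - X * o) * w) X 0ℚ (0≤* (0≤q-p Xo≤a) 0≤w) ow≡1 ow≡1
    (solve 4 (λ X o w a → a :* w := X :+ (a :- X :* o) :* w :+ X :* (o :* w :- con 1ℚ) :+
      con 0ℚ :* (o :* w :- con 1ℚ)) refl X o w a)

  ≤-/ : ∀ b a o (0<o : 0ℝ Defs.< fromℚ o) → proj₁ 0<o ≤ o →
    ∀ N → (∀ n → N ℕ.≤ n → seq b n * o ≤ seq a n) → b Defs.≤ a Defs./ fromℚ o [ 0<o ]
  ≤-/ b a o 0<o gap≤o N bo≤a = eventually-≤ {b} {a Defs./ fromℚ o [ 0<o ]} (N , λ n N≤n →
    let (ow≡1 , 0≤w) = inv-seq (fromℚ o) 0<o n gap≤o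
    in ≤-÷ {seq b n} {o} {seq (inv (fromℚ o) 0<o) n} {seq a n} ow≡1 0≤w (bo≤a n N≤n))

  reciprocals-vanish : ∀ C (d : ℕ → ℚ) → (∀ k → 0ℚ ≤ d k) → (∀ k → d k * ι (suc k) ≡ 1ℚ) →
    TendsToZero (λ k → fromℚ (ι C * d k))
  -- `M` is chosen with `1 ≤ M * (½ * e)`, so `C * d k` is at most `½ * e` from `C * M` on. The
  -- other half of `e` supplies the gap that the strict order demands.
  reciprocals-vanish C d 0≤d dK≡1 ε (e , 0<e , N , e≤ε) = C ℕ.* M , λ k CM≤k →
    (e , 0<e , N , λ n N≤n → ℚ.≤-trans
      (≤-gap (seq ε n - (0ℚ + e)) (0≤q-p (e≤ε n N≤n))
        (solve 2 (λ x e → con 0ℚ := :- x :+ e :+ (x :- (con 0ℚ :+ e))) refl (seq ε n) e))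
      (0≤* (0≤ι C) (0≤d k))) ,
    (½ * e , 0<½e , N , λ n N≤n → ℚ.≤-trans
      (ℚ.+-monoˡ-≤ (½ * e) (small k CM≤k))
      (ℚ.≤-trans (ℚ.≤-reflexive (solve 1 (λ e → con ½ :* e :+ con ½ :* e := con 0ℚ :+ e) refl e)) (e≤ε n N≤n)))
    where
    0<½e : 0ℚ < ½ * e
    0<½e = ℚ.positive⁻¹ (½ * e) {{ℚ.pos*pos⇒pos ½ e {{positive 0<e}}}}
    M : ℕ
    M = proj₁ (archimedean (½ * e) 0<½e)
    small : ∀ k → C ℕ.* M ℕ.≤ k → ι C * d k ≤ ½ * e
    small k CM≤k = ≤-gap-mod
      (½ * e * d k * (ι (suc k) - ι C * ι M) + d k * ι C * (ι M * (½ * e) - 1ℚ)) (- (½ * e)) 0ℚ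
      (0≤+ (0≤* (0≤* (ℚ.<⇒≤ 0<½e) (0≤d k))
          (0≤q-p (subst (_≤ ι (suc k)) (ι-* C M) (ι-mono-≤ (ℕ.m≤n⇒m≤1+n CM≤k)))))
        (0≤* (0≤* (0≤d k) (0≤ι C)) (0≤q-p (proj₂ (archimedean (½ * e) 0<½e)))))
      (dK≡1 k) (dK≡1 k)
      (solve 5 (λ h d K C M → h := C :* d :+
        (h :* d :* (K :- C :* M) :+ d :* C :* (M :* h :- con 1ℚ)) :+
        (:- h) :* (d :* K :- con 1ℚ) :+ con 0ℚ :* (d :* K :- con 1ℚ))
        refl (½ * e) (d k) (ι (suc k)) (ι C) (ι M))

-- The two families of hard instances and the choice between them.

module Construction (q : ℝ) (0<q : 0ℝ Defs.< q) (q<1 : q Defs.< 1ℝ) where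
  open import Data.Rational.Base
  open import Data.Rational.Solver using (module +-*-Solver)
  open +-*-Solver
  open RationalArithmetic
  open Reciprocal
  open LeafCost

  ε : ℚ
  ε = proj₁ 0<q

  N₀ : ℕ
  N₀ = proj₁ (proj₂ (proj₂ 0<q)) ℕ.⊔ proj₁ (proj₂ (proj₂ q<1))

  -- An integer bound on 1/q, obtained from the gap of `0<q`. It makes the error an explicit
  -- multiple of `D k`, that is, of 1/(k + 1).
  Y : ℕ
  Y = proj₁ (archimedean ε (proj₁ (proj₂ 0<q)))

  ε≤q : ∀ n → N₀ ℕ.≤ n → ε ≤ seq q n
  ε≤q n N₀≤n = subst (_≤ seq q n) (ℚ.+-identityˡ ε)
    (proj₂ (proj₂ (proj₂ 0<q)) n (ℕ.≤-trans (ℕ.m≤m⊔n _ (proj₁ (proj₂ (proj₂ q<1)))) N₀≤n))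

  q≤1 : ∀ n → N₀ ℕ.≤ n → seq q n ≤ 1ℚ
  q≤1 n N₀≤n = ℚ.≤-trans (≤-gap (proj₁ q<1) (ℚ.<⇒≤ (proj₁ (proj₂ q<1))) refl)
    (proj₂ (proj₂ (proj₂ q<1)) n (ℕ.≤-trans (ℕ.m≤n⊔m (proj₁ (proj₂ (proj₂ 0<q))) _) N₀≤n))

  D r : ℕ → ℚ
  r k = ½ * (ℤ.+ 1 / suc k)
  D k = r k + r k

  0<r : ∀ k → 0ℚ < r k
  0<r k = ℚ.positive⁻¹ (r k) {{ℚ.pos*pos⇒pos ½ (ℤ.+ 1 / suc k) {{ℚ.normalize-pos 1 (suc k)}}}}

  0≤D : ∀ k → 0ℚ ≤ D k
  0≤D k = 0≤+ (ℚ.<⇒≤ (0<r k)) (ℚ.<⇒≤ (0<r k))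

  DK≡1 : ∀ k → D k * ι (suc k) ≡ 1ℚ
  DK≡1 k = trans (solve 2 (λ d K → (con ½ :* d :+ con ½ :* d) :* K := K :* d) refl
    (ℤ.+ 1 / suc k) (ι (suc k))) (ι-*-inverse (suc k))

  D≤1 : ∀ k → D k ≤ 1ℚ
  D≤1 k = ≤-gap-mod (D k * (ι (suc k) - 1ℚ)) (- 1ℚ) 0ℚ
    (0≤* (0≤D k) (0≤q-p (ι-mono-≤ {1} {suc k} (ℕ.s≤s ℕ.z≤n)))) (DK≡1 k) (DK≡1 k)
    (solve 2 (λ d K → con 1ℚ := d :+ d :* (K :- con 1ℚ) :+ con (- 1ℚ) :* (d :* K :- con 1ℚ) :+
      con 0ℚ :* (d :* K :- con 1ℚ)) refl (D k) (ι (suc k)))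

  bound : ℕ → ℝ
  bound k = (1ℝ Defs.+ q) Defs.* (2ℝ Defs.⊔ (1ℝ Defs./ q [ 0<q ])) Defs.- fromℚ (ι (12 ℕ.+ 6 ℕ.* Y) * D k)

  -- The ratio bound is multiplied out by the optimum and asked only from some index on, which turns
  -- it into an inequality of rationals.
  record HardInstance (k : ℕ) : Set₁ where
    field
      hard    : Instance
      optimum : ℚ
      isOPT   : IsOPT hard (fromℚ optimum)
      -- The positivity proof `0<OPT` has gap ½, and `inv` is exact for values not below its gap.
      ½≤opt   : ½ ≤ optimum
      N       : ℕ
      ALG≥    : ∀ n → N ℕ.≤ n → seq (bound k) n * optimum ≤ seq (E (qDistProb q hard)) n

  module AtIndex (k n : ℕ) (N₀≤n : N₀ ℕ.≤ n) where
    x y : ℚ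
    x = seq q n
    y = seq (inv q 0<q) n

    0≤x : 0ℚ ≤ x
    0≤x = ℚ.≤-trans (ℚ.<⇒≤ (proj₁ (proj₂ 0<q))) (ε≤q n N₀≤n)

    xy≡1 : x * y ≡ 1ℚ
    xy≡1 = proj₁ (inv-seq q 0<q n (ε≤q n N₀≤n))

    0≤y : 0ℚ ≤ y
    0≤y = proj₂ (inv-seq q 0<q n (ε≤q n N₀≤n))

    1≤Yx : 1ℚ ≤ ι Y * x
    1≤Yx = ℚ.≤-trans (proj₂ (archimedean ε (proj₁ (proj₂ 0<q))))
      (ℚ.*-monoˡ-≤-nonNeg (ι Y) {{nonNegative (0≤ι Y)}} (ε≤q n N₀≤n))

    open Estimates {x} {y} {ι Y} {D k} {ι (suc k)}
      0≤x (q≤1 n N₀≤n) xy≡1 0≤y 1≤Yx (0≤ι Y) (0≤D k) (0≤ι (suc k)) (DK≡1 k)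
      public

    xD≤1 : x * D k ≤ 1ℚ
    xD≤1 = ≤-gap ((1ℚ - x) + x * (1ℚ - D k))
      (0≤+ (0≤q-p (q≤1 n N₀≤n)) (0≤* 0≤x (0≤q-p (D≤1 k))))
      (solve 2 (λ x d → con 1ℚ := x :* d :+ ((con 1ℚ :- x) :+ x :* (con 1ℚ :- d))) refl x (D k))

    T : ℚ
    T = ι 2 ⊔ y

    bound≡ : seq (bound k) n ≡ (1ℚ + x) * T - (ι 12 + ι 6 * ι Y) * D k
    bound≡ = cong₂ (λ t c → (1ℚ + x) * (ι 2 ⊔ t) - c * D k) (ℚ.*-identityˡ y)
      (trans (ι-+ 12 (6 ℕ.* Y)) (cong (ι 12 +_) (ι-* 6 Y)))

  0<D : ∀ k → 0ℚ < D k
  0<D k = ℚ.+-mono-< (0<r k) (0<r k)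

  N₁ : ℕ → ℕ
  N₁ k = proj₁ (cauchy q (D k) (0<D k))

  approximation : ℕ → ℚ
  approximation k = seq q (N₁ k)

  q≤approximation : ∀ k n → N₁ k ℕ.≤ n → seq q n ≤ approximation k + D k
  q≤approximation k n N₁≤n = ℚ.≤-trans (p≤q+∣p-q∣ (seq q n) (approximation k))
    (ℚ.+-monoʳ-≤ (approximation k) (ℚ.<⇒≤ (proj₂ (cauchy q (D k) (0<D k)) n (N₁ k) N₁≤n ℕ.≤-refl)))

  approximation≤q : ∀ k n → N₁ k ℕ.≤ n → approximation k ≤ seq q n + D k
  approximation≤q k n N₁≤n = ℚ.≤-trans (p≤q+∣p-q∣ (approximation k) (seq q n))
    (ℚ.+-monoʳ-≤ (seq q n) (ℚ.<⇒≤ (proj₂ (cauchy q (D k) (0<D k)) (N₁ k) n ℕ.≤-refl N₁≤n)))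

  ½≤1 : ½ ≤ 1ℚ
  ½≤1 = from-yes (½ ℚ.≤? 1ℚ)

  centreInstance : ∀ k → ½ ≤ approximation k → HardInstance k
  centreInstance k ½≤Q = record
    { hard    = starInstance
    ; optimum = 1ℚ + ι (suc (suc k ℕ.* suc k)) * r k
    ; isOPT   = OPT-centre refl (ℕ.s≤s ℕ.z≤n) (D≤1 k)
    ; ½≤opt   = ℚ.≤-trans ½≤1
        (≤-gap (ι (suc (suc k ℕ.* suc k)) * r k) (0≤* (0≤ι (suc (suc k ℕ.* suc k))) (ℚ.<⇒≤ (0<r k))) refl)
    ; N       = N₀ ℕ.⊔ N₁ k
    ; ALG≥    = λ n N≤n → ALG≥ n (ℕ.≤-trans (ℕ.m≤m⊔n N₀ (N₁ k)) N≤n)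
        (ℕ.≤-trans (ℕ.m≤n⊔m N₀ (N₁ k)) N≤n)
    }
    where
    -- One demand on each of 1 + (k + 1)² leaves. As `D k` is 1/(k + 1), the assignment cost from
    -- the centre grows like (k + 1)/2 and its opening cost becomes negligible.
    open StarInstance (r k) (0<r k) 0 (suc k ℕ.* suc k)
    ALG≥ : ∀ n → N₀ ℕ.≤ n → N₁ k ℕ.≤ n →
      seq (bound k) n * (1ℚ + ι (suc (suc k ℕ.* suc k)) * r k) ≤ seq (E (qDistProb q starInstance)) n
    ALG≥ n N₀≤n N₁≤n = subst (seq (bound k) n * (1ℚ + ι (suc (suc k ℕ.* suc k)) * r k) ≤_)
      (sym (E-star q n xD≤1))
      (subst (λ b → b * (1ℚ + ι (suc (suc k ℕ.* suc k)) * r k) ≤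
          1ℚ + (ι (suc (suc k ℕ.* suc k)) * A - A)) (sym bound≡)
      (subst₂ (λ m ρ → ((1ℚ + x) * T - (ι 12 + ι 6 * ι Y) * D k) * (1ℚ + m * ρ) ≤ 1ℚ + (m * A - A))
        (sym (trans (ι-suc (suc k ℕ.* suc k)) (cong (1ℚ +_) (ι-* (suc k) (suc k)))))
        (solve 1 (λ r → con ½ :* (r :+ r) := r) refl (r k))
        (centre-ratio (2⊔y≤2+ (ℚ.≤-trans ½≤Q (approximation≤q k n N₁≤n))))))
      where
      open AtIndex k n N₀≤n
      A : ℚ
      A = leafCost (x * D k) (D k) 1

  leavesInstance : ∀ k → approximation k ≤ ½ → HardInstance k
  leavesInstance k Q≤½ = record
    { hard    = starInstance
    ; optimum = ι K
    ; isOPT   = OPT-leaves 1≤cr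
    ; ½≤opt   = ℚ.≤-trans ½≤1 (ι-mono-≤ {1} {K} (ℕ.s≤s ℕ.z≤n))
    ; N       = N₀ ℕ.⊔ N₁ k
    ; ALG≥    = λ n N≤n → ALG≥ n (ℕ.≤-trans (ℕ.m≤m⊔n N₀ (N₁ k)) N≤n)
        (ℕ.≤-trans (ℕ.m≤n⊔m N₀ (N₁ k)) N≤n)
    }
    where
    K c : ℕ
    K = suc k
    -- The first summand makes leaving a leaf without facility as expensive as
    -- opening it; the second one makes the algorithm open almost every leaf.
    c = 2 ℕ.* K ℕ.+ Y ℕ.* (K ℕ.* K)
    open StarInstance (r k) (0<r k) c k
    2K≤c : ι 2 * ι K ≤ ι (suc c)
    2K≤c = subst (_≤ ι (suc c)) (ι-* 2 K)
      (ι-mono-≤ (ℕ.m≤n⇒m≤1+n (ℕ.m≤m+n (2 ℕ.* K) (Y ℕ.* (K ℕ.* K)))))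
    YKK≤c : ι Y * (ι K * ι K) ≤ ι (suc c)
    YKK≤c = subst (_≤ ι (suc c)) (trans (ι-* Y (K ℕ.* K)) (cong (ι Y *_) (ι-* K K)))
      (ι-mono-≤ (ℕ.m≤n⇒m≤1+n (ℕ.m≤n+m (Y ℕ.* (K ℕ.* K)) (2 ℕ.* K))))
    1≤cr : 1ℚ ≤ ι (suc c) * r k
    1≤cr = ≤-gap-mod ((ι (suc c) - ι 2 * ι K) * r k) 1ℚ 0ℚ
      (0≤* (0≤q-p 2K≤c) (ℚ.<⇒≤ (0<r k))) (DK≡1 k) (DK≡1 k)
      (solve 3 (λ c r K → c :* r := con 1ℚ :+ (c :- con (ι 2) :* K) :* r :+
        con 1ℚ :* ((r :+ r) :* K :- con 1ℚ) :+ con 0ℚ :* ((r :+ r) :* K :- con 1ℚ)) refl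
        (ι (suc c)) (r k) (ι K))
    ALG≥ : ∀ n → N₀ ℕ.≤ n → N₁ k ℕ.≤ n →
      seq (bound k) n * ι K ≤ seq (E (qDistProb q starInstance)) n
    ALG≥ n N₀≤n N₁≤n = subst (seq (bound k) n * ι K ≤_) (sym (E-star q n xD≤1))
      (subst (λ b → b * ι K ≤ 1ℚ + (ι K * A - A)) (sym bound≡)
        (leaves-ratio (2⊔y≤y+ (ℚ.≤-trans (q≤approximation k n N₁≤n) (ℚ.+-monoˡ-≤ (D k) Q≤½)))
          0≤e
          (ℚ.≤-trans eK≤ (deficit-bound p (D k) 0≤B xD≤1 fixed (suc c)))))
      where
      open AtIndex k n N₀≤n
      p A B : ℚ
      p = x * D k
      A = leafCost p (D k) (suc c)
      -- The solution of `p * B = p + (1 - p) * D` for `p = x * D`, by `x * y = 1`.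
      B = 1ℚ + y - D k
      0≤B : 0ℚ ≤ B
      0≤B = subst (0ℚ ≤_) (solve 2 (λ y d → (con 1ℚ :- d) :+ y := con 1ℚ :+ y :- d) refl y (D k))
        (0≤+ (0≤q-p (D≤1 k)) 0≤y)
      fixed : p * B ≡ p + (1ℚ - p) * D k
      fixed = trans
        (solve 3 (λ x y d → x :* d :* (con 1ℚ :+ y :- d) := x :* d :+ (x :* y :- x :* d) :* d) refl x y (D k))
        (cong (λ u → p + (u - p) * D k) xy≡1)
      0≤e : 0ℚ ≤ B - A
      0≤e = 0≤deficit p (D k) 0≤B xD≤1 fixed (suc c)
      -- The summand `Y * (K * K)` of `c` gives `p * c ≥ x * Y * K`, by `D * K = 1`, and
      -- `x * Y ≥ 1`. With this, `deficit-bound` yields the deficit hypothesis of `leaves-ratio`.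
      K≤pc : ι K ≤ p * ι (suc c)
      K≤pc = ≤-gap-mod (p * (ι (suc c) - ι Y * (ι K * ι K)) + (ι Y * x - 1ℚ) * ι K)
        (ι Y * x * ι K) 0ℚ
        (0≤+ (0≤* (0≤* 0≤x (0≤D k)) (0≤q-p YKK≤c)) (0≤* (0≤q-p 1≤Yx) (0≤ι K)))
        (DK≡1 k) (DK≡1 k)
        (solve 5 (λ x d c Y K → x :* d :* c := K :+
          (x :* d :* (c :- Y :* (K :* K)) :+ (Y :* x :- con 1ℚ) :* K) :+
          Y :* x :* K :* (d :* K :- con 1ℚ) :+ con 0ℚ :* (d :* K :- con 1ℚ)) refl
          x (D k) (ι (suc c)) (ι Y) (ι K))
      eK≤ : (B - A) * ι K ≤ (B - A) * (1ℚ + p * ι (suc c))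
      eK≤ = ≤-gap ((B - A) * (1ℚ + (p * ι (suc c) - ι K)))
        (0≤* 0≤e (0≤+ 0≤1 (0≤q-p K≤pc)))
        (solve 3 (λ e z K → e :* (con 1ℚ :+ z) := e :* K :+ e :* (con 1ℚ :+ (z :- K))) refl
          (B - A) (p * ι (suc c)) (ι K))

  ratio-bound : ∀ {k} (h : HardInstance k) → let open HardInstance h in
    bound k Defs.≤ E (qDistProb q hard) Defs./ fromℚ optimum [ 0<OPT hard (fromℚ optimum) isOPT ]
  ratio-bound {k} h =
    ≤-/ (bound k) (E (qDistProb q hard)) optimum (0<OPT hard (fromℚ optimum) isOPT) ½≤opt N ALG≥
    where open HardInstance h

  abstract
    -- Either choice is sound when q is close to ½, since 2 and 1/q then differ by a multiple of
    -- `D k`, which the error term covers.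
    hardInstance : ∀ k → HardInstance k
    hardInstance k = [ centreInstance k , leavesInstance k ]′ (ℚ.≤-total ½ (approximation k))

open import Defs using (_≤_; _<_; _+_; _*_; _-_; _⊔_)

corollary4p4 : (q : ℝ) (0<q : 0ℝ < q) → q < 1ℝ →
    Σ[ I ∈ (ℕ → Instance) ]
    Σ[ opt ∈ (ℕ → ℝ) ]
    Σ[ isOPT ∈ (∀ k → IsOPT (I k) (opt k)) ]
    Σ[ δ ∈ (ℕ → ℝ) ]
      TendsToZero δ ×
      (∀ k → (1ℝ + q) * (2ℝ ⊔ (1ℝ / q [ 0<q ])) - δ k
               ≤ E (qDistProb q (I k)) / opt k [ 0<OPT (I k) (opt k) (isOPT k) ])
corollary4p4 q 0<q q<1 =
  (λ k → hard (hardInstance k)) , (λ k → fromℚ (optimum (hardInstance k))) ,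
  (λ k → isOPT (hardInstance k)) , (λ k → fromℚ (ι (12 ℕ.+ 6 ℕ.* Y) ℚ.* D k)) ,
  reciprocals-vanish (12 ℕ.+ 6 ℕ.* Y) D 0≤D DK≡1 , (λ k → ratio-bound (hardInstance k))
  where
  open Construction q 0<q q<1
  open HardInstance
  open RationalArithmetic using (ι)
  open Reciprocal using (reciprocals-vanish)
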